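{- Let $G$ be a finite simple undirected graph and let $\lambda$ be an integer. Then \begin{align*} m_A(G, \lambda) &\leq \theta(G)-\tau(G)+\mathrm{v}_\mathrm{o}(G)+2\mathrm{c}_\mathrm{e}(G)-\mathrm{c}(G)+2i(G) && \text{if $\lambda$ is even},\\ m_A(G, \lambda) &\leq \theta(G)-\tau(G)+\mathrm{v}_\mathrm{e}(G)+\mathrm{c}(G) && \text{if $\lambda$ is odd},\\ m_L(G, \lambda),\ m_Q(G, \lambda) &\leq \theta(G)-\tau(G)+\mathrm{c}(G) && \text{if $\lambda$ is even},\\ m_L(G, \lambda),\ m_Q(G, \lambda) &\leq \mathrm{v}(G)-\beta(G)-\mathrm{c}(G) && \text{if $\lambda$ is odd}. \end{align*}
   Context: For a graph $G$ with vertices $v_1,\dots,v_n$: $A(G)$ is the adjacency matrix, $D(G)$ the diagonal degree matrix, $L(G)=D(G)-A(G)$ the Laplacian, $Q(G)=D(G)+A(G)$ the signless Laplacian. For a real symmetric matrix $M(G)$, $m_M(G,\lambda)$ denotes the multiplicity of $\lambda$ as an eigenvalue of $M(G)$ (which is $0$ if $\lambda$ is not an eigenvalue), i.e. the dimension of the real kernel of $M(G)-\lambda I$. $\mathrm{v}(G)$, $\mathrm{e}(G)$, $\mathrm{c}(G)$ are the numbers of vertices, edges and connected components; $\mathrm{v}_\mathrm{e}(G)$ and $\mathrm{v}_\mathrm{o}(G)$ are the numbers of vertices of even and odd degree; a graph is even if all its vertices have even degree, and $\mathrm{c}_\mathrm{e}(G)$ is the number of connected components of $G$ that are even; $i(G)=0$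 if $G$ is even and $i(G)=1$ otherwise. The edge space is the $\mathbb{F}_2$-vector space of subsets of $E(G)$ under symmetric difference. The cycle space is the subspace of edge sets in which every vertex has even degree; its dimension $\theta(G)=\mathrm{e}(G)-\mathrm{v}(G)+\mathrm{c}(G)$ is the circuit rank. The cut space consists of all edge sets $\{uv\in E(G): u\in S, v\notin S\}$ for $S\subseteq V(G)$. The bicycle space is the intersection of the cycle space and the cut space; $\beta(G)$ is its dimension. A cycle is odd if it has an odd number of edges; two cycles are disjoint if they share no edge; $\tau(G)$ is the maximum cardinality of a set of pairwise (edge-)disjoint odd cycles of $G$.
   Formalization: The multiplicity is taken as the dimension of the rational kernel of M(G) − λI instead of the real kernel; the two agree because M(G) − λI has integer entries and rank does not change under field extension. -}

module Defs where

open import Data.Bool using (Bool; true; false; _∧_; _∨_; not; _xor_; if_then_else_)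
open import Data.Nat as ℕ using (ℕ; zero; suc; _≡ᵇ_; _<ᵇ_; _≤ᵇ_; _%_)
open import Data.Fin using (Fin; zero; suc; toℕ; inject₁; fromℕ)
open import Data.Integer as ℤ using (ℤ; +_)
open import Data.Rational as ℚ using (ℚ; 0ℚ; 1ℚ; _/_)
open import Data.Product using (_×_; Σ)
open import Data.Sum using (_⊎_)
open import Relation.Binary.PropositionalEquality using (_≡_; _≢_)
open import Relation.Nullary using (¬_)
open import Function using (_∘_)

record Graph : Set where
  field
    n     : ℕ
    adj   : Fin n → Fin n → Bool
    sym   : ∀ u v → adj u v ≡ adj v u
    loopless : ∀ u → adj u u ≡ false
open Graph public

sumℚ : ∀ {k} → (Fin k → ℚ) → ℚ
sumℚ {zero}  f = 0ℚ
sumℚ {suc k} f = f zero ℚ.+ sumℚ (f ∘ suc)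

count : ∀ {k} → (Fin k → Bool) → ℕ
count {zero}  p = 0
count {suc k} p = (if p zero then 1 else 0) ℕ.+ count (p ∘ suc)

sumℕ : ∀ {k} → (Fin k → ℕ) → ℕ
sumℕ {zero}  f = 0
sumℕ {suc k} f = f zero ℕ.+ sumℕ (f ∘ suc)

anyFin : ∀ {k} → (Fin k → Bool) → Bool
anyFin {zero}  p = false
anyFin {suc k} p = p zero ∨ anyFin (p ∘ suc)

allFin : ∀ {k} → (Fin k → Bool) → Bool
allFin {zero}  p = true
allFin {suc k} p = p zero ∧ allFin (p ∘ suc)

xorSum : ∀ {k} → (Fin k → Bool) → Bool
xorSum {zero}  p = false
xorSum {suc k} p = p zero xor xorSum (p ∘ suc)

eqFin : ∀ {k} → Fin k → Fin k → Bool
eqFin i j = toℕ i ≡ᵇ toℕ j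

isEven : ℕ → Bool
isEven m = m % 2 ≡ᵇ 0

deg : (G : Graph) → Fin (n G) → ℕ
deg G u = count (adj G u)

nV : Graph → ℕ
nV G = n G

nE : Graph → ℕ
nE G = sumℕ (λ u → count (λ v → adj G u v ∧ (toℕ u <ᵇ toℕ v)))

nVe : Graph → ℕ
nVe G = count (λ u → isEven (deg G u))

nVo : Graph → ℕ
nVo G = count (λ u → not (isEven (deg G u)))

reachN : (G : Graph) → ℕ → Fin (n G) → Fin (n G) → Bool
reachN G zero    u v = eqFin u v
reachN G (suc k) u v = reachN G k u v ∨ anyFin (λ w → reachN G k u w ∧ adj G w v)

reach : (G : Graph) → Fin (n G) → Fin (n G) → Bool
reach G = reachN G (n G)

isRep : (G : Graph) → Fin (n G) → Bool
isRep G v = allFin (λ u → not (reach G v u) ∨ (toℕ v ≤ᵇ toℕ u))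

nC : Graph → ℕ
nC G = count (isRep G)

nCe : Graph → ℕ
nCe G = count (λ v → isRep G v ∧ allFin (λ u → not (reach G v u) ∨ isEven (deg G u)))

iG : Graph → ℕ
iG G = if allFin (λ u → isEven (deg G u)) then 0 else 1

θ : Graph → ℤ
θ G = (+ nE G ℤ.- + nV G) ℤ.+ + nC G

bℚ : Bool → ℚ
bℚ b = if b then 1ℚ else 0ℚ

ℕℚ : ℕ → ℚ
ℕℚ m = + m / 1

Mat : ℕ → Set
Mat k = Fin k → Fin k → ℚ

Amat : (G : Graph) → Mat (n G)
Amat G i j = bℚ (adj G i j)

Dmat : (G : Graph) → Mat (n G)
Dmat G i j = if eqFin i j then ℕℚ (deg G i) else 0ℚ

Lmat : (G : Graph) → Mat (n G)
Lmat G i j = Dmat G i j ℚ.- Amat G i j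

Qmat : (G : Graph) → Mat (n G)
Qmat G i j = Dmat G i j ℚ.+ Amat G i j

InKernel : ∀ {k} → Mat k → ℚ → (Fin k → ℚ) → Set
InKernel M μ x = ∀ i → sumℚ (λ j → M i j ℚ.* x j) ℚ.- μ ℚ.* x i ≡ 0ℚ

-- A family of m linearly independent vectors in the kernel of M - μ I.
-- m_M(G,μ) is the largest m for which such a family exists.
record EigFamily {k : ℕ} (M : Mat k) (μ : ℚ) (m : ℕ) : Set where
  field
    vec    : Fin m → Fin k → ℚ
    inKer  : ∀ a → InKernel M μ (vec a)
    indep  : ∀ (c : Fin m → ℚ) →
             (∀ i → sumℚ (λ a → c a ℚ.* vec a i) ≡ 0ℚ) → ∀ a → c a ≡ 0ℚ

record OddCycle (G : Graph) : Set where
  field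
    len    : ℕ
    walk   : Fin (suc len) → Fin (n G)
    len≥3  : 3 ℕ.≤ len
    oddLen : isEven len ≡ false
    closed : walk zero ≡ walk (fromℕ len)
    adjs   : ∀ (i : Fin len) → adj G (walk (inject₁ i)) (walk (suc i)) ≡ true
    distinct : ∀ (i j : Fin len) → walk (inject₁ i) ≡ walk (inject₁ j) → i ≡ j
open OddCycle public

edgeEnds : ∀ {G} (C : OddCycle G) → Fin (len C) → Fin (n G) × Fin (n G)
edgeEnds C i = walk C (inject₁ i) Data.Product., walk C (suc i)

SameEdge : ∀ {k} → Fin k × Fin k → Fin k × Fin k → Set
SameEdge (a Data.Product., b) (c Data.Product., d) = (a ≡ c × b ≡ d) ⊎ (a ≡ d × b ≡ c)

EdgeDisjoint : ∀ {G} → OddCycle G → OddCycle G → Set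
EdgeDisjoint C D = ∀ i j → ¬ SameEdge (edgeEnds C i) (edgeEnds D j)

-- t pairwise edge-disjoint odd cycles; τ(G) is the largest such t
record DisjOddCycles (G : Graph) (t : ℕ) : Set where
  field
    cyc  : Fin t → OddCycle G
    disj : ∀ p q → p ≢ q → EdgeDisjoint (cyc p) (cyc q)

-- Bicycle space (over F₂). An edge set is represented by its symmetric
-- indicator  mem u v  on vertex pairs.

record Bicycle (G : Graph) : Set where
  field
    mem   : Fin (n G) → Fin (n G) → Bool
    side  : Fin (n G) → Bool
    isCut : ∀ u v → mem u v ≡ (adj G u v ∧ (side u xor side v))
    isCyc : ∀ u → isEven (count (mem u)) ≡ true
open Bicycle public

-- b bicycles linearly independent over F₂; β(G) is the largest such b
record BicycleFamily (G : Graph) (b : ℕ) : Set where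
  field
    bic   : Fin b → Bicycle G
    indep : ∀ (c : Fin b → Bool) →
            (∀ u v → xorSum (λ a → c a ∧ mem (bic a) u v) ≡ false) →
            ∀ a → c a ≡ false

{-# OPTIONS --safe #-}
-- Scaling and eliminating over the rationals turns k independent eigenvectors of an integer
-- matrix into k independent eigenvectors of its reduction mod 2.  Over 𝔽₂ both L and Q become
-- D + A, whose kernel consists of the vertex sets x whose cut δx is a cycle-space element.
-- A cut is orthogonal to the cycle space, whereas edge-disjoint odd cycles are orthonormal, so
-- cuts δx and odd cycles are independent of each other and all orthogonal to the vertex stars;
-- a dimension count in the edge space gives the even Laplacian bound.  An eigenvector of A
-- satisfies (D + A) x = s x with s = deg + λ; appending the coordinates x v with s v = 1 to δx
-- restores the orthogonality at the cost of count s extra dimensions.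
-- For odd λ, the eigenvectors of D + A for 1 are orthogonal to its kernel, which contains
-- the bicycles' sides and the component indicators.
module Submission where

open import Defs renaming (sym to adj-sym)

open import Algebra.Bundles using (CommutativeRing)
open import Data.Bool using (Bool; true; false; _∧_; _∨_; _xor_; not; if_then_else_)
import Data.Bool.Properties as 𝔹ₚ
open import Data.Bool.Solver using (module xor-∧-Solver)
open import Data.Fin as Fin using (Fin; zero; suc; toℕ; inject₁; fromℕ; punchIn; _↑ˡ_; _↑ʳ_)
open import Data.Fin.Properties as Finₚ using (any?; splitAt⁻¹-↑ˡ; splitAt⁻¹-↑ʳ)
open import Data.Integer as ℤ using (ℤ; +_; -[1+_]; ∣_∣; _⊖_)
import Data.Integer.Properties as ℤₚ
open import Data.Integer.Divisibility using (_∣_)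
import Data.Integer.Divisibility.Signed as ℤ∣
open import Data.Integer.Solver using () renaming (module +-*-Solver to ℤ-Solver)
open import Data.List as List using (List; []; _∷_; length; lookup; _++_; concat; tabulate)
import Data.List.Properties as Listₚ
open import Data.List.Membership.Propositional using (_∈_)
open import Data.List.Membership.Propositional.Properties using (∈-lookup; ∈-++⁺ˡ; ∈-++⁺ʳ)
open import Data.List.Relation.Unary.Any using (here; there)
open import Data.Nat as ℕ using (ℕ; zero; suc; z≤n; s≤s; _<ᵇ_; _≡ᵇ_)
import Data.Nat.Divisibility as ℕ∣
open import Data.Nat.Induction using (<-wellFounded)
import Data.Nat.Properties as ℕₚ
open import Data.Nat.Solver using () renaming (module +-*-Solver to ℕ-Solver)
open import Data.Product using (∃; _×_; _,_; proj₁; proj₂)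
open import Data.Rational as ℚ using (ℚ; 0ℚ; 1ℚ; ½; _/_)
import Data.Rational.Properties as ℚₚ
import Data.Rational.Unnormalised as ℚᵘ
import Data.Rational.Unnormalised.Properties as ℚᵘₚ
open import Data.Sum using (_⊎_; inj₁; inj₂)
open import Data.Unit using (⊤; tt)
open import Data.Vec.Functional as Vec using (insertAt)
open import Data.Vec.Functional.Properties using (insertAt-lookup; insertAt-punchIn)
open import Function using (_∘_)
open import Function.Bundles using (Equivalence)
open import Induction.WellFounded using (Acc; acc)
open import Level using (0ℓ)
open import Relation.Binary.Definitions using (tri<; tri≈; tri>)
open import Relation.Binary.PropositionalEquality as ≡
  using (_≡_; _≢_; refl; cong; cong₂; trans; sym; subst; subst₂; module ≡-Reasoning)
open import Relation.Nullary using (¬_; Dec; yes; no; contradiction)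
open import Relation.Nullary.Decidable using (¬?; decidable-stable; _×-dec_)

-- Linear algebra over a field with decidable equality

-- Dimensions enter only through independent families, and the sole dimension formula is an
-- inequality: two mutually orthogonal independent families on m coordinates have at most m members
-- together. It requires no positive definiteness, which matters over 𝔽₂, where for instance a
-- bicycle is orthogonal to itself. No basis of a subspace is ever chosen; a family that fails to be
-- independent is repaired by extra coordinates. The n vertex stars satisfy one relation per
-- component, so each component gets a coordinate that breaks the relation, and another one that
-- detects the vertex sets with empty cut. These two are the source of 2c in n + k + t ≤ e + 2c,
-- which is k ≤ θ - t + c, the even Laplacian bound. For `Amat` and even eigenvalues the coordinates
-- at odd-degree vertices already do both jobs on every component that has such a vertex, so only
-- the even components are paid for twice.

record DecidableField : Set₁ where
  field
    commutativeRing : CommutativeRing 0ℓ 0ℓ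
  open CommutativeRing commutativeRing public
  field
    zero?   : ∀ x → Dec (x ≈ 0#)
    inverse : ∀ x → ¬ x ≈ 0# → ∃ λ y → y * x ≈ 1#
    1≉0     : ¬ 1# ≈ 0#

module LinearAlgebra (F : DecidableField) where
  open DecidableField F hiding (zero) renaming (Carrier to K; refl to ≈-refl; sym to ≈-sym; trans to ≈-trans)
  open import Algebra.Properties.Semiring.Sum semiring
  open import Algebra.Properties.Ring ring using (-‿distribˡ-*)
  open import Relation.Binary.Reasoning.Setoid setoid

  comb : ∀ {I : Set} {m} → (Fin m → K) → (Fin m → I → K) → I → K
  comb c f i = sum (λ a → c a * f a i)

  -- The predicate `S` selects the coordinates on which a combination is tested, so that elimination
  -- can drop coordinates while the index type stays fixed.
  Independent : ∀ {I : Set} {m} → (I → Set) → (Fin m → I → K) → Set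
  Independent S f = ∀ c → (∀ i → S i → comb c f i ≈ 0#) → ∀ a → c a ≈ 0#

  sum-≈0 : ∀ {m} (f : Fin m → K) → (∀ a → f a ≈ 0#) → sum f ≈ 0#
  sum-≈0 {m} f f≈0 = ≈-trans (sum-cong-≋ f≈0) (sum-replicate-zero m)

  comb-++ : ∀ {I : Set} {m k} (c : Fin (m ℕ.+ k) → K) (f : Fin m → I → K) (g : Fin k → I → K) i →
            comb c (f Vec.++ g) i ≈ comb (λ a → c (a ↑ˡ k)) f i + comb (λ a → c (m ↑ʳ a)) g i
  comb-++ {m = zero}  c f g i = ≈-sym (+-identityˡ _)
  comb-++ {m = suc m} c f g i = begin
    c zero * f zero i + sum (λ a → c (suc a) * (f Vec.++ g) (suc a) i)
      ≈⟨ +-congˡ (sum-cong-≋ λ a → *-congˡ (reflexive (≡.cong (λ h → h i) (shift a)))) ⟩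
    c zero * f zero i + comb (c ∘ suc) ((f ∘ suc) Vec.++ g) i
      ≈⟨ +-congˡ (comb-++ (c ∘ suc) (f ∘ suc) g i) ⟩
    c zero * f zero i + (comb (λ a → c (suc a ↑ˡ _)) (f ∘ suc) i + comb (λ a → c (suc m ↑ʳ a)) g i)
      ≈⟨ +-assoc _ _ _ ⟨
    comb (λ a → c (a ↑ˡ _)) f i + comb (λ a → c (suc m ↑ʳ a)) g i ∎
    where
    shift : ∀ a → (f Vec.++ g) (suc a) ≡ ((f ∘ suc) Vec.++ g) a
    shift a with Fin.splitAt m a
    ... | inj₁ _ = refl
    ... | inj₂ _ = refl

  independent-++ : ∀ {I : Set} {S : I → Set} {m k} {f : Fin m → I → K} {g : Fin k → I → K} →
    (∀ c d → (∀ i → S i → comb c f i + comb d g i ≈ 0#) → (∀ a → c a ≈ 0#) × (∀ a → d a ≈ 0#)) →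
    Independent S (f Vec.++ g)
  independent-++ {m = m} {k} {f} {g} ind c Σ≈0 a
    with ind (λ a → c (a ↑ˡ k)) (λ a → c (m ↑ʳ a))
             (λ i Si → ≈-trans (≈-sym (comb-++ c f g i)) (Σ≈0 i Si))
  ... | c≈0 , d≈0 with Fin.splitAt m a in eq
  ... | inj₁ a′ = ≡.subst (λ a → c a ≈ 0#) (splitAt⁻¹-↑ˡ eq) (c≈0 a′)
  ... | inj₂ a′ = ≡.subst (λ a → c a ≈ 0#) (splitAt⁻¹-↑ʳ eq) (d≈0 a′)

  -- A step of Gaussian elimination with the pivot vector `f b` discarded. The multipliers `k` stay
  -- free; `pivot` chooses them so as to clear one coordinate.
  shear : ∀ {I : Set} {m} → Fin (suc m) → (Fin m → K) → (Fin (suc m) → I → K) → Fin m → I → K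
  shear b k f a i = f (punchIn b a) i + k a * f b i

  comb-shear : ∀ {I : Set} {m} b k (f : Fin (suc m) → I → K) c i →
               comb (insertAt c b (sum (λ a → c a * k a))) f i ≈ comb c (shear b k f) i
  comb-shear b k f c i = begin
    sum (λ a → c′ a * f a i)
      ≈⟨ sum-remove (λ a → c′ a * f a i) ⟩
    c′ b * f b i + sum (λ a → c′ (punchIn b a) * f (punchIn b a) i)
      ≈⟨ +-cong (*-congʳ (reflexive (insertAt-lookup c b _)))
                (sum-cong-≋ λ a → *-congʳ (reflexive (insertAt-punchIn c b _ a))) ⟩
    sum (λ a → c a * k a) * f b i + sum (λ a → c a * f (punchIn b a) i)
      ≈⟨ +-comm _ _ ⟩
    sum (λ a → c a * f (punchIn b a) i) + sum (λ a → c a * k a) * f b i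
      ≈⟨ +-congˡ (*-distribʳ-sum (f b i) (λ a → c a * k a)) ⟩
    sum (λ a → c a * f (punchIn b a) i) + sum (λ a → c a * k a * f b i)
      ≈⟨ ∑-distrib-+ (λ a → c a * f (punchIn b a) i) (λ a → c a * k a * f b i) ⟨
    sum (λ a → c a * f (punchIn b a) i + c a * k a * f b i)
      ≈⟨ sum-cong-≋ (λ a → ≈-trans (+-congˡ (*-assoc (c a) (k a) (f b i)))
                                   (≈-sym (distribˡ (c a) (f (punchIn b a) i) (k a * f b i)))) ⟩
    comb c (shear b k f) i ∎
    where c′ = insertAt c b (sum (λ a → c a * k a))

  -- By `comb-shear`, a relation among the sheared vectors is a relation among the original ones
  -- with the coefficients `c` unchanged away from `b`; the original independence makes all of them
  -- vanish.
  shear-independent : ∀ {I : Set} {S : I → Set} {m} b k {f : Fin (suc m) → I → K} →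
                      Independent S f → Independent S (shear b k f)
  shear-independent b k {f} ind c Σ≈0 a = ≈-trans
    (reflexive (≡.sym (insertAt-punchIn c b (sum (λ a → c a * k a)) a)))
    (ind (insertAt c b (sum (λ a → c a * k a))) (λ i Si → ≈-trans (comb-shear b k f c i) (Σ≈0 i Si)) (punchIn b a))

  pivot : ∀ {I : Set} {m} (f : Fin (suc m) → I → K) b i → ¬ f b i ≈ 0# → Fin m → K
  pivot f b i f≉0 a = - (f (punchIn b a) i * proj₁ (inverse (f b i) f≉0))

  pivot-vanishes : ∀ {I : Set} {m} (f : Fin (suc m) → I → K) b i f≉0 a →
                   shear b (pivot f b i f≉0) f a i ≈ 0#
  pivot-vanishes f b i f≉0 a = begin
    x + - (x * y) * f b i   ≈⟨ +-congˡ (-‿distribˡ-* (x * y) (f b i)) ⟨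
    x + - (x * y * f b i)   ≈⟨ +-congˡ (-‿cong (*-assoc _ _ _)) ⟩
    x + - (x * (y * f b i)) ≈⟨ +-congˡ (-‿cong (*-congˡ (proj₂ (inverse (f b i) f≉0)))) ⟩
    x + - (x * 1#)          ≈⟨ +-congˡ (-‿cong (*-identityʳ x)) ⟩
    x + - x                 ≈⟨ -‿inverseʳ x ⟩
    0#                      ∎
    where
    x = f (punchIn b a) i
    y = proj₁ (inverse (f b i) f≉0)

  -- Orthogonal families and their dimension bound

  dot : ∀ {I : Set} → List I → (I → K) → (I → K) → K
  dot l x y = sum (λ j → x (lookup l j) * y (lookup l j))

  dot-comm : ∀ {I : Set} (l : List I) x y → dot l x y ≈ dot l y x
  dot-comm l x y = sum-cong-≋ (λ j → *-comm (x (lookup l j)) (y (lookup l j)))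

  dot-comb : ∀ {I : Set} {m} (l : List I) x c (u : Fin m → I → K) →
             dot l x (comb c u) ≈ sum (λ a → c a * dot l x (u a))
  dot-comb l x c u = begin
    sum (λ j → x (e j) * sum (λ a → c a * u a (e j)))
      ≈⟨ sum-cong-≋ (λ j → *-distribˡ-sum (x (e j)) (λ a → c a * u a (e j))) ⟩
    sum (λ j → sum (λ a → x (e j) * (c a * u a (e j))))
      ≈⟨ ∑-comm (λ j a → x (e j) * (c a * u a (e j))) ⟩
    sum (λ a → sum (λ j → x (e j) * (c a * u a (e j))))
      ≈⟨ sum-cong-≋ (λ a → ≈-trans (sum-cong-≋ (λ j → swap (x (e j)) (c a) (u a (e j))))
                                   (≈-sym (*-distribˡ-sum (c a) (λ j → x (e j) * u a (e j))))) ⟩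
    sum (λ a → c a * dot l x (u a)) ∎
    where
    e = lookup l
    swap : ∀ p q r → p * (q * r) ≈ q * (p * r)
    swap p q r = ≈-trans (≈-sym (*-assoc p q r)) (≈-trans (*-congʳ (*-comm p q)) (*-assoc q p r))

  dot-shear : ∀ {I : Set} {m} (l : List I) b k (f : Fin (suc m) → I → K) a y →
              dot l (shear b k f a) y ≈ dot l (f (punchIn b a)) y + k a * dot l (f b) y
  dot-shear l b k f a y = begin
    sum (λ j → (f (punchIn b a) (e j) + k a * f b (e j)) * y (e j))
      ≈⟨ sum-cong-≋ (λ j → ≈-trans (distribʳ (y (e j)) _ _) (+-congˡ (*-assoc (k a) (f b (e j)) (y (e j))))) ⟩
    sum (λ j → f (punchIn b a) (e j) * y (e j) + k a * (f b (e j) * y (e j)))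
      ≈⟨ ∑-distrib-+ (λ j → f (punchIn b a) (e j) * y (e j)) (λ j → k a * (f b (e j) * y (e j))) ⟩
    dot l (f (punchIn b a)) y + sum (λ j → k a * (f b (e j) * y (e j)))
      ≈⟨ +-congˡ (*-distribˡ-sum (k a) (λ j → f b (e j) * y (e j))) ⟨
    dot l (f (punchIn b a)) y + k a * dot l (f b) y ∎
    where e = lookup l

  independent-tail : ∀ {I : Set} {i : I} {l m} (f : Fin m → I → K) →
    Independent (_∈ i ∷ l) f → (∀ a → f a i ≈ 0#) → Independent (_∈ l) f
  independent-tail f ind fi≈0 c Σ≈0 = ind c λ where
    i (here refl) → sum-≈0 _ (λ a → ≈-trans (*-congˡ (fi≈0 a)) (zeroʳ (c a)))
    i (there i∈l) → Σ≈0 i i∈l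

  dot-tail : ∀ {I : Set} {i : I} l x y → x i ≈ 0# → dot (i ∷ l) x y ≈ 0# → dot l x y ≈ 0#
  dot-tail {i = i} l x y xi≈0 d≈0 = begin
    dot l x y             ≈⟨ +-identityˡ _ ⟨
    0# + dot l x y        ≈⟨ +-congʳ (≈-trans (*-congʳ xi≈0) (zeroˡ (y i))) ⟨
    dot (i ∷ l) x y       ≈⟨ d≈0 ⟩
    0#                    ∎

  *-cancel-≉0 : ∀ {x y} → ¬ x ≈ 0# → x * y ≈ 0# → y ≈ 0#
  *-cancel-≉0 {x} {y} x≉0 xy≈0 with z , zx≈1 ← inverse x x≉0 = begin
    y           ≈⟨ *-identityˡ y ⟨
    1# * y      ≈⟨ *-congʳ zx≈1 ⟨
    z * x * y   ≈⟨ *-assoc z x y ⟩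
    z * (x * y) ≈⟨ *-congˡ xy≈0 ⟩
    z * 0#      ≈⟨ zeroʳ z ⟩
    0#          ∎

  -- If a combination of the u vanishes on l, its product with x is x i times its i-th
  -- coordinate; orthogonality then kills that coordinate too.
  independent-orthogonal-tail : ∀ {I : Set} {i : I} {l m} (x : I → K) (u : Fin m → I → K) →
    ¬ x i ≈ 0# → Independent (_∈ i ∷ l) u → (∀ a → dot (i ∷ l) x (u a) ≈ 0#) → Independent (_∈ l) u
  independent-orthogonal-tail {i = i} {l} x u xi≉0 ind x⊥u c Σ≈0 = ind c λ where
      j (here refl) → *-cancel-≉0 xi≉0 xi*Σ≈0
      j (there j∈l) → Σ≈0 j j∈l
    where
    tail≈0 : dot l x (comb c u) ≈ 0#
    tail≈0 = sum-≈0 _ (λ j → ≈-trans (*-congˡ (Σ≈0 _ (∈-lookup j))) (zeroʳ (x (lookup l j))))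
    xi*Σ≈0 : x i * comb c u i ≈ 0#
    xi*Σ≈0 = begin
      x i * comb c u i                              ≈⟨ +-identityʳ _ ⟨
      x i * comb c u i + 0#                         ≈⟨ +-congˡ tail≈0 ⟨
      dot (i ∷ l) x (comb c u)                      ≈⟨ dot-comb (i ∷ l) x c u ⟩
      sum (λ a → c a * dot (i ∷ l) x (u a))         ≈⟨ sum-≈0 _ (λ a → ≈-trans (*-congˡ (x⊥u a)) (zeroʳ (c a))) ⟩
      0#                                            ∎

  private
    Bound : ∀ {I : Set} → List I → Set
    Bound {I} l = ∀ {r s} (f : Fin r → I → K) (u : Fin s → I → K) →
      Independent (_∈ l) f → Independent (_∈ l) u → (∀ a b → dot l (f a) (u b) ≈ 0#) →
      r ℕ.+ s ℕ.≤ length l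

    -- One coordinate is traded for one vector: `f b` is spent on clearing coordinate `i` from the
    -- rest of `f`, while `u` keeps all its members, because orthogonality to `f b` determines the
    -- entry at `i` of any combination from its entries on `l`. Taking `Bound l` as an argument lets
    -- either family play the role of `f`.
    pivot-bound : ∀ {I : Set} {i : I} {l} → Bound l → ∀ {r s} (f : Fin r → I → K) (u : Fin s → I → K) →
      Independent (_∈ i ∷ l) f → Independent (_∈ i ∷ l) u → (∀ a b → dot (i ∷ l) (f a) (u b) ≈ 0#) →
      (∃ λ b → ¬ f b i ≈ 0#) → r ℕ.+ s ℕ.≤ suc (length l)
    pivot-bound {i = i} {l} bound {suc r} f u f-ind u-ind f⊥u (b , fbi≉0) = s≤s (bound f′ u
      (independent-tail f′ (shear-independent b k {f} f-ind) f′i≈0)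
      (independent-orthogonal-tail (f b) u fbi≉0 u-ind (f⊥u b))
      (λ a b′ → dot-tail l (f′ a) (u b′) (f′i≈0 a) (f′⊥u a b′)))
      where
      k = pivot f b i fbi≉0
      f′ = shear b k f
      f′i≈0 = pivot-vanishes f b i fbi≉0
      f′⊥u : ∀ a b′ → dot (i ∷ l) (f′ a) (u b′) ≈ 0#
      f′⊥u a b′ = begin
        dot (i ∷ l) (f′ a) (u b′)
          ≈⟨ dot-shear (i ∷ l) b k f a (u b′) ⟩
        dot (i ∷ l) (f (punchIn b a)) (u b′) + k a * dot (i ∷ l) (f b) (u b′)
          ≈⟨ +-cong (f⊥u (punchIn b a) b′) (≈-trans (*-congˡ (f⊥u b b′)) (zeroʳ (k a))) ⟩
        0# + 0#
          ≈⟨ +-identityˡ 0# ⟩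
        0# ∎

    nonzero? : ∀ {I : Set} {m} (f : Fin m → I → K) i → Dec (∃ λ b → ¬ f b i ≈ 0#)
    nonzero? f i = any? (λ b → ¬? (zero? (f b i)))

    none⇒≈0 : ∀ {I : Set} {m} (f : Fin m → I → K) i → ¬ (∃ λ b → ¬ f b i ≈ 0#) → ∀ a → f a i ≈ 0#
    none⇒≈0 f i none a = decidable-stable (zero? _) (λ fai≉0 → none (a , fai≉0))

  independent-[] : ∀ {I : Set} {m} {f : Fin m → I → K} → Independent (_∈ []) f → m ≡ 0
  independent-[] {m = zero}  ind = refl
  independent-[] {m = suc m} ind = contradiction (ind (λ _ → 1#) (λ _ ()) zero) 1≉0

  -- This replaces dim W + dim W⊥ = dim of the whole space. The induction removes one coordinate at
  -- a time; whichever family is nonzero there supplies the pivot, and if both vanish there the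
  -- coordinate is simply dropped.
  orthogonal-bound : ∀ {I : Set} (l : List I) {r s} (f : Fin r → I → K) (u : Fin s → I → K) →
    Independent (_∈ l) f → Independent (_∈ l) u → (∀ a b → dot l (f a) (u b) ≈ 0#) →
    r ℕ.+ s ℕ.≤ length l
  orthogonal-bound [] f u f-ind u-ind _
    rewrite independent-[] f-ind | independent-[] u-ind = z≤n
  orthogonal-bound (i ∷ l) {r} {s} f u f-ind u-ind f⊥u with nonzero? f i
  ... | yes f≉0 = pivot-bound (orthogonal-bound l) f u f-ind u-ind f⊥u f≉0
  ... | no  f≈0 with nonzero? u i
  ...   | yes u≉0 = ≡.subst (ℕ._≤ suc (length l)) (ℕₚ.+-comm s r)
            (pivot-bound (orthogonal-bound l) u f u-ind f-ind
              (λ a b → ≈-trans (dot-comm (i ∷ l) (u a) (f b)) (f⊥u b a)) u≉0)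
  ...   | no u≈0 = ℕₚ.m≤n⇒m≤1+n (orthogonal-bound l f u
            (independent-tail f f-ind (none⇒≈0 f i f≈0)) (independent-tail u u-ind (none⇒≈0 u i u≈0))
            (λ a b → dot-tail l (f a) (u b) (none⇒≈0 f i f≈0 a) (f⊥u a b)))

  independent-∷ : ∀ {I : Set} {S : I → Set} {m} (f : Fin (suc m) → I → K) {i} → S i →
    ¬ f zero i ≈ 0# → (∀ a → f (suc a) i ≈ 0#) → Independent S (f ∘ suc) → Independent S f
  independent-∷ f {i} Si f0i≉0 fi≈0 ind c Σ≈0 = λ where
      zero    → c0≈0
      (suc a) → ind (c ∘ suc) tail≈0 a
    where
    c0≈0 : c zero ≈ 0#
    c0≈0 = *-cancel-≉0 f0i≉0 (begin
      f zero i * c zero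
        ≈⟨ *-comm _ _ ⟩
      c zero * f zero i
        ≈⟨ +-identityʳ _ ⟨
      c zero * f zero i + 0#
        ≈⟨ +-congˡ (sum-≈0 _ (λ a → ≈-trans (*-congˡ (fi≈0 a)) (zeroʳ (c (suc a))))) ⟨
      comb c f i
        ≈⟨ Σ≈0 i Si ⟩
      0# ∎)
    tail≈0 : ∀ j → _ → comb (c ∘ suc) (f ∘ suc) j ≈ 0#
    tail≈0 j Sj = begin
      comb (c ∘ suc) (f ∘ suc) j
        ≈⟨ +-identityˡ _ ⟨
      0# + comb (c ∘ suc) (f ∘ suc) j
        ≈⟨ +-congʳ (≈-trans (*-congʳ c0≈0) (zeroˡ (f zero j))) ⟨
      comb c f j
        ≈⟨ Σ≈0 j Sj ⟩
      0# ∎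

  independent⇒head≉0 : ∀ {n m} {S : Fin n → Set} (f : Fin (suc m) → Fin n → K) →
    Independent S f → ∃ λ i → ¬ f zero i ≈ 0#
  independent⇒head≉0 {m = m} f ind with any? (λ i → ¬? (zero? (f zero i)))
  ... | yes nonzero = nonzero
  ... | no  none = contradiction (ind e₀ (λ i _ → comb≈0 i) zero) 1≉0
    where
    e₀ : Fin (suc m) → K
    e₀ = 1# Vec.∷ λ _ → 0#
    comb≈0 : ∀ i → comb e₀ f i ≈ 0#
    comb≈0 i = sum-≈0 (λ a → e₀ a * f a i) λ where
      zero    → ≈-trans (*-congˡ (decidable-stable (zero? _) (λ f≉0 → none (i , f≉0)))) (zeroʳ 1#)
      (suc a) → zeroˡ (f (suc a) i)

𝔽₂ : DecidableField
𝔽₂ = record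
  { commutativeRing = 𝔹ₚ.xor-∧-commutativeRing
  ; zero?   = 𝔹ₚ._≟ false
  ; inverse = λ { true _ → true , refl ; false 0≢0 → contradiction refl 0≢0 }
  ; 1≉0     = λ ()
  }

ℚ-field : DecidableField
ℚ-field = record
  { commutativeRing = ℚₚ.+-*-commutativeRing
  ; zero?   = ℚₚ._≟ 0ℚ
  ; inverse = λ x x≢0 → let instance _ = ℚ.≢-nonZero x≢0 in ℚ.1/ x , ℚₚ.*-inverseˡ x
  ; 1≉0     = λ ()
  }

module F₂ = LinearAlgebra 𝔽₂
module Fℚ = LinearAlgebra ℚ-field
open F₂ using () renaming (sum-≈0 to sum₂-false; comb to comb₂; Independent to Independent₂)

open import Algebra.Properties.Semiring.Sum (DecidableField.semiring 𝔽₂) using ()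
  renaming (sum to sum₂; sum-cong-≗ to sum₂-cong; ∑-distrib-+ to sum₂-xor; ∑-comm to sum₂-comm;
            *-distribˡ-sum to ∧-distribˡ-sum₂; *-distribʳ-sum to ∧-distribʳ-sum₂)
open import Algebra.Properties.Semiring.Sum (DecidableField.semiring ℚ-field)
  using (∑-distrib-+; *-distribˡ-sum; sum-cong-≗) renaming (sum to sumQ)
open import Algebra.Properties.Group ℚₚ.+-0-group using (x∙y⁻¹≈ε⇒x≈y)
open import Algebra.Properties.Ring (DecidableField.ring ℚ-field) using (-1*x≈-x)

-- Reduction modulo 2

odd : ℕ → Bool
odd zero    = false
odd (suc m) = not (odd m)

odd-+ : ∀ m n → odd (m ℕ.+ n) ≡ odd m xor odd n
odd-+ zero    n = refl
odd-+ (suc m) n = trans (cong not (odd-+ m n)) (𝔹ₚ.not-distribˡ-xor (odd m) (odd n))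

odd-* : ∀ m n → odd (m ℕ.* n) ≡ odd m ∧ odd n
odd-* zero    n = refl
odd-* (suc m) n = trans (odd-+ n (m ℕ.* n)) (trans (cong (odd n xor_) (odd-* m n)) (distrib (odd m) (odd n)))
  where
  distrib : ∀ a b → b xor (a ∧ b) ≡ not a ∧ b
  distrib false b = 𝔹ₚ.xor-identityʳ b
  distrib true  b = 𝔹ₚ.xor-same b

odd-∣⊖∣ : ∀ m n → odd ∣ m ⊖ n ∣ ≡ odd m xor odd n
odd-∣⊖∣ zero    zero    = refl
odd-∣⊖∣ zero    (suc n) = refl
odd-∣⊖∣ (suc m) zero    = sym (𝔹ₚ.xor-identityʳ _)
odd-∣⊖∣ (suc m) (suc n) = begin
  odd ∣ suc m ⊖ suc n ∣       ≡⟨ cong (odd ∘ ∣_∣) (ℤₚ.[1+m]⊖[1+n]≡m⊖n m n) ⟩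
  odd ∣ m ⊖ n ∣               ≡⟨ odd-∣⊖∣ m n ⟩
  odd m xor odd n             ≡⟨ not-xor-not (odd m) (odd n) ⟨
  not (odd m) xor not (odd n) ∎
  where
  open ≡-Reasoning
  not-xor-not : ∀ a b → not a xor not b ≡ a xor b
  not-xor-not true  b = refl
  not-xor-not false b = 𝔹ₚ.not-involutive b

odd-∣+∣ : ∀ i j → odd ∣ i ℤ.+ j ∣ ≡ odd ∣ i ∣ xor odd ∣ j ∣
odd-∣+∣ (+ m)    (+ n)    = odd-+ m n
odd-∣+∣ (+ m)    -[1+ n ] = odd-∣⊖∣ m (suc n)
odd-∣+∣ -[1+ m ] (+ n)    = trans (odd-∣⊖∣ n (suc m)) (𝔹ₚ.xor-comm (odd n) (odd (suc m)))
odd-∣+∣ -[1+ m ] -[1+ n ] = trans (cong odd (cong suc (sym (ℕₚ.+-suc m n)))) (odd-+ (suc m) (suc n))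

odd-∣*∣ : ∀ i j → odd ∣ i ℤ.* j ∣ ≡ odd ∣ i ∣ ∧ odd ∣ j ∣
odd-∣*∣ i j = trans (cong odd (ℤₚ.abs-* i j)) (odd-* ∣ i ∣ ∣ j ∣)

¬odd⇒2∣ : ∀ m → odd m ≡ false → 2 ℕ∣.∣ m
¬odd⇒2∣ zero          _ = 2 ℕ∣.∣0
¬odd⇒2∣ (suc (suc m)) p = ℕ∣.∣m∣n⇒∣m+n ℕ∣.∣-refl (¬odd⇒2∣ m (trans (sym (𝔹ₚ.not-involutive (odd m))) p))

2∣⇒¬odd : ∀ {m} → 2 ℕ∣.∣ m → odd m ≡ false
2∣⇒¬odd (ℕ∣.divides q refl) = trans (odd-* q 2) (𝔹ₚ.∧-zeroʳ (odd q))

ι : ℤ → ℚ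
ι z = z / 1

private
  ιᵘ : ∀ z → ℚ.toℚᵘ (ι z) ℚᵘ.≃ ℚᵘ.mkℚᵘ z 0
  ιᵘ z = ℚₚ.toℚᵘ-fromℚᵘ (ℚᵘ.mkℚᵘ z 0)

ι-+ : ∀ a b → ι a ℚ.+ ι b ≡ ι (a ℤ.+ b)
ι-+ a b = ℚₚ.toℚᵘ-injective (begin
  ℚ.toℚᵘ (ι a ℚ.+ ι b)              ≈⟨ ℚₚ.toℚᵘ-homo-+ (ι a) (ι b) ⟩
  ℚ.toℚᵘ (ι a) ℚᵘ.+ ℚ.toℚᵘ (ι b)    ≈⟨ ℚᵘₚ.+-cong (ιᵘ a) (ιᵘ b) ⟩
  ℚᵘ.mkℚᵘ a 0 ℚᵘ.+ ℚᵘ.mkℚᵘ b 0      ≈⟨ ℚᵘ.*≡* (cong (ℤ._* + 1) (cong₂ ℤ._+_ (ℤₚ.*-identityʳ a) (ℤₚ.*-identityʳ b))) ⟩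
  ℚᵘ.mkℚᵘ (a ℤ.+ b) 0               ≈⟨ ιᵘ (a ℤ.+ b) ⟨
  ℚ.toℚᵘ (ι (a ℤ.+ b))              ∎)
  where open import Relation.Binary.Reasoning.Setoid ℚᵘₚ.≃-setoid

ι-* : ∀ a b → ι a ℚ.* ι b ≡ ι (a ℤ.* b)
ι-* a b = ℚₚ.toℚᵘ-injective (begin
  ℚ.toℚᵘ (ι a ℚ.* ι b)              ≈⟨ ℚₚ.toℚᵘ-homo-* (ι a) (ι b) ⟩
  ℚ.toℚᵘ (ι a) ℚᵘ.* ℚ.toℚᵘ (ι b)    ≈⟨ ℚᵘₚ.*-cong (ιᵘ a) (ιᵘ b) ⟩
  ℚᵘ.mkℚᵘ (a ℤ.* b) 0               ≈⟨ ιᵘ (a ℤ.* b) ⟨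
  ℚ.toℚᵘ (ι (a ℤ.* b))              ∎)
  where open import Relation.Binary.Reasoning.Setoid ℚᵘₚ.≃-setoid

ι-injective : ∀ {a b} → ι a ≡ ι b → a ≡ b
ι-injective {a} {b} eq
  with ℚᵘ.*≡* a*1≡b*1 ← ℚᵘₚ.≃-trans (ℚᵘₚ.≃-sym (ιᵘ a)) (ℚᵘₚ.≃-trans (ℚᵘₚ.≃-reflexive (cong ℚ.toℚᵘ eq)) (ιᵘ b))
  = trans (sym (ℤₚ.*-identityʳ a)) (trans a*1≡b*1 (ℤₚ.*-identityʳ b))

ι-↧*q : ∀ q → ι (ℚ.↧ q) ℚ.* q ≡ ι (ℚ.↥ q)
ι-↧*q q@record{} = ℚₚ.toℚᵘ-injective (begin
  ℚ.toℚᵘ (ι (ℚ.↧ q) ℚ.* q)            ≈⟨ ℚₚ.toℚᵘ-homo-* (ι (ℚ.↧ q)) q ⟩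
  ℚ.toℚᵘ (ι (ℚ.↧ q)) ℚᵘ.* ℚ.toℚᵘ q    ≈⟨ ℚᵘₚ.*-cong (ιᵘ (ℚ.↧ q)) (ℚᵘₚ.≃-refl {ℚ.toℚᵘ q}) ⟩
  ℚᵘ.mkℚᵘ (ℚ.↧ q) 0 ℚᵘ.* ℚ.toℚᵘ q     ≈⟨ ℚᵘ.*≡* (trans (ℤₚ.*-identityʳ (ℚ.↧ q ℤ.* ℚ.↥ q)) (trans (ℤₚ.*-comm (ℚ.↧ q) (ℚ.↥ q))
                                            (cong (λ d → ℚ.↥ q ℤ.* + d) (sym (ℕₚ.+-identityʳ _))))) ⟩
  ℚᵘ.mkℚᵘ (ℚ.↥ q) 0                   ≈⟨ ιᵘ (ℚ.↥ q) ⟨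
  ℚ.toℚᵘ (ι (ℚ.↥ q))                  ∎)
  where open import Relation.Binary.Reasoning.Setoid ℚᵘₚ.≃-setoid

-- A relation instead of a function, since only rationals with integer value have a residue. It is
-- compatible with the ring operations and single-valued by `reduces-unique`, which is how equations
-- over ℚ become equations over 𝔽₂.
Reduces : ℚ → Bool → Set
Reduces q b = ∃ λ z → q ≡ ι z × odd ∣ z ∣ ≡ b

reduces-+ : ∀ {p q a b} → Reduces p a → Reduces q b → Reduces (p ℚ.+ q) (a xor b)
reduces-+ (y , refl , refl) (z , refl , refl) = y ℤ.+ z , ι-+ y z , odd-∣+∣ y z

reduces-* : ∀ {p q a b} → Reduces p a → Reduces q b → Reduces (p ℚ.* q) (a ∧ b)
reduces-* (y , refl , refl) (z , refl , refl) = y ℤ.* z , ι-* y z , odd-∣*∣ y z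

reduces-0 : Reduces 0ℚ false
reduces-0 = + 0 , refl , refl

reduces-1 : Reduces 1ℚ true
reduces-1 = + 1 , refl , refl

reduces-neg : ∀ {q b} → Reduces q b → Reduces (ℚ.- q) b
reduces-neg {q} r = subst (λ p → Reduces p _) (-1*x≈-x q) (reduces-* (ℤ.- + 1 , refl , refl) r)

reduces-unique : ∀ {q a b} → Reduces q a → Reduces q b → a ≡ b
reduces-unique (y , refl , refl) (z , ιy≡ιz , refl) = cong (odd ∘ ∣_∣) (ι-injective {y} {z} ιy≡ιz)

reduces-sum : ∀ {k} {f : Fin k → ℚ} {g : Fin k → Bool} → (∀ i → Reduces (f i) (g i)) → Reduces (sumQ f) (sum₂ g)
reduces-sum {zero}  r = reduces-0
reduces-sum {suc k} r = reduces-+ (r zero) (reduces-sum (r ∘ suc))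

clear-denominators : ∀ {n} (x : Fin n → ℚ) → ∃ λ d → d ≢ + 0 × ∃ λ (z : Fin n → ℤ) → ∀ i → ι d ℚ.* x i ≡ ι (z i)
clear-denominators {zero}  x = + 1 , (λ ()) , (λ ()) , λ ()
clear-denominators {suc n} x with clear-denominators (x ∘ suc)
... | d , d≢0 , z , dx≡z = d ℤ.* e , de≢0 , z′ , dex≡z′
  where
  e = ℚ.↧ x zero
  de≢0 : d ℤ.* e ≢ + 0
  de≢0 de≡0 with ℤₚ.i*j≡0⇒i≡0∨j≡0 d de≡0
  -- A denominator is a successor by definition, so the case `e ≡ + 0` is empty.
  ... | inj₁ d≡0 = d≢0 d≡0
  z′ : Fin (suc n) → ℤ
  z′ zero    = d ℤ.* ℚ.↥ x zero
  z′ (suc i) = e ℤ.* z i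
  dex≡z′ : ∀ i → ι (d ℤ.* e) ℚ.* x i ≡ ι (z′ i)
  dex≡z′ zero = begin
    ι (d ℤ.* e) ℚ.* x zero       ≡⟨ cong (ℚ._* x zero) (ι-* d e) ⟨
    ι d ℚ.* ι e ℚ.* x zero       ≡⟨ ℚₚ.*-assoc (ι d) (ι e) (x zero) ⟩
    ι d ℚ.* (ι e ℚ.* x zero)     ≡⟨ cong (ι d ℚ.*_) (ι-↧*q (x zero)) ⟩
    ι d ℚ.* ι (ℚ.↥ x zero)       ≡⟨ ι-* d (ℚ.↥ x zero) ⟩
    ι (d ℤ.* ℚ.↥ x zero)         ∎
    where open ≡-Reasoning
  dex≡z′ (suc i) = begin
    ι (d ℤ.* e) ℚ.* x (suc i)    ≡⟨ cong (λ c → ι c ℚ.* x (suc i)) (ℤₚ.*-comm d e) ⟩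
    ι (e ℤ.* d) ℚ.* x (suc i)    ≡⟨ cong (ℚ._* x (suc i)) (ι-* e d) ⟨
    ι e ℚ.* ι d ℚ.* x (suc i)    ≡⟨ ℚₚ.*-assoc (ι e) (ι d) (x (suc i)) ⟩
    ι e ℚ.* (ι d ℚ.* x (suc i))  ≡⟨ cong (ι e ℚ.*_) (dx≡z i) ⟩
    ι e ℚ.* ι (z i)              ≡⟨ ι-* e (z i) ⟩
    ι (e ℤ.* z i)                ∎
    where open ≡-Reasoning

halve : ∀ z → odd ∣ z ∣ ≡ false → ∃ λ w → z ≡ + 2 ℤ.* w
halve z even with ℤ∣.divides w z≡w*2 ← ℤ∣.∣ᵤ⇒∣ {+ 2} {z} (¬odd⇒2∣ ∣ z ∣ even)
  = w , trans z≡w*2 (ℤₚ.*-comm w (+ 2))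

-- Dividing an integer vector by 2 as long as all its entries are even decreases ∣ z p ∣.
odd-scaling-ℤ : ∀ {n} (x : Fin n → ℚ) (z : Fin n → ℤ) q p → Acc ℕ._<_ ∣ z p ∣ → z p ≢ + 0 →
  (∀ i → q ℚ.* x i ≡ ι (z i)) →
  ∃ λ r → ∃ λ (y : Fin n → Bool) → (∀ i → Reduces (r ℚ.* x i) (y i)) × ∃ λ i → y i ≡ true
odd-scaling-ℤ x z q p (acc rec) zp≢0 qx≡z with any? (λ i → odd ∣ z i ∣ 𝔹ₚ.≟ true)
... | yes oddEntry = q , (λ i → odd ∣ z i ∣) , (λ i → z i , qx≡z i , refl) , oddEntry
... | no  allEven  = odd-scaling-ℤ x w (½ ℚ.* q) p (rec ∣wp∣<∣zp∣) wp≢0 qx/2≡w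
  where
  half : ∀ i → ∃ λ w → z i ≡ + 2 ℤ.* w
  half i = halve (z i) (𝔹ₚ.¬-not (λ oddEntry → allEven (i , oddEntry)))
  w = proj₁ ∘ half
  wp≢0 : w p ≢ + 0
  wp≢0 wp≡0 = zp≢0 (trans (proj₂ (half p)) (cong (+ 2 ℤ.*_) wp≡0))
  ∣wp∣<∣zp∣ : ∣ w p ∣ ℕ.< ∣ z p ∣
  ∣wp∣<∣zp∣ = subst (∣ w p ∣ ℕ.<_) (sym (trans (cong ∣_∣ (proj₂ (half p))) (ℤₚ.abs-* (+ 2) (w p))))
    (ℕₚ.m<m+n ∣ w p ∣ (ℕₚ.<-≤-trans (ℕₚ.n≢0⇒n>0 (wp≢0 ∘ ℤₚ.∣i∣≡0⇒i≡0)) (ℕₚ.m≤m+n ∣ w p ∣ 0)))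
  qx/2≡w : ∀ i → ½ ℚ.* q ℚ.* x i ≡ ι (w i)
  qx/2≡w i = begin
    ½ ℚ.* q ℚ.* x i              ≡⟨ ℚₚ.*-assoc ½ q (x i) ⟩
    ½ ℚ.* (q ℚ.* x i)            ≡⟨ cong (½ ℚ.*_) (trans (qx≡z i) (cong ι (proj₂ (half i)))) ⟩
    ½ ℚ.* ι (+ 2 ℤ.* w i)        ≡⟨ cong (½ ℚ.*_) (ι-* (+ 2) (w i)) ⟨
    ½ ℚ.* (ι (+ 2) ℚ.* ι (w i))  ≡⟨ ℚₚ.*-assoc ½ (ι (+ 2)) (ι (w i)) ⟨
    1ℚ ℚ.* ι (w i)               ≡⟨ ℚₚ.*-identityˡ (ι (w i)) ⟩
    ι (w i)                      ∎
    where open ≡-Reasoning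

odd-scaling : ∀ {n} (x : Fin n → ℚ) p → x p ≢ 0ℚ →
  ∃ λ r → ∃ λ (y : Fin n → Bool) → (∀ i → Reduces (r ℚ.* x i) (y i)) × ∃ λ i → y i ≡ true
odd-scaling x p xp≢0 with clear-denominators x
... | d , d≢0 , z , dx≡z = odd-scaling-ℤ x z (ι d) p (<-wellFounded ∣ z p ∣) zp≢0 dx≡z
  where
  zp≢0 : z p ≢ + 0
  zp≢0 zp≡0 = xp≢0 (Fℚ.*-cancel-≉0 (d≢0 ∘ ι-injective {d}) (trans (dx≡z p) (cong ι zp≡0)))

-- Each step scales one vector to an integer vector whose reduction has a nonzero entry at some p,
-- and clears the entry at p from the remaining vectors: the reductions come out in echelon form.
reduce-family : ∀ {n} (P : (Fin n → ℚ) → Set) →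
  (∀ q x → P x → P (λ i → q ℚ.* x i)) → (∀ x y → P x → P y → P (λ i → x i ℚ.+ y i)) →
  ∀ {k} (v : Fin k → Fin n → ℚ) → (∀ a → P (v a)) → Fℚ.Independent (λ _ → ⊤) v →
  ∃ λ (y : Fin k → Fin n → Bool) → F₂.Independent (λ _ → ⊤) y × (∀ a → ∃ λ x → P x × (∀ i → Reduces (x i) (y a i)))
reduce-family P P-* P-+ {zero} v Pv ind = (λ ()) , (λ _ _ ()) , λ ()
reduce-family {n} P P-* P-+ {suc k} v Pv ind
  with j , vj≢0 ← Fℚ.independent⇒head≉0 v ind
  with q , y₀ , qv-y₀ , p , y₀p≡1 ← odd-scaling (v zero) j vj≢0
  = y , F₂.independent-∷ y tt (λ y₀p≡0 → contradiction (trans (sym y₀p≡1) y₀p≡0) λ ()) yp≡0 y′-ind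
    , λ { zero → (λ i → q ℚ.* v zero i) , P-* q (v zero) (Pv zero) , qv-y₀
        ; (suc a) → let x , (Px , _) , x-y = y′-lift a in x , Px , x-y }
  where
  vp≢0 : v zero p ≢ 0ℚ
  vp≢0 vp≡0 = contradiction
    (reduces-unique (subst₂ Reduces (trans (cong (q ℚ.*_) vp≡0) (ℚₚ.*-zeroʳ q)) y₀p≡1 (qv-y₀ p)) reduces-0) λ ()
  -- Putting the vanishing at `p` into the predicate makes the recursion return lifts that still
  -- vanish there, hence reductions with entry `false` at `p`. This is why `P` is an arbitrary
  -- predicate closed under the linear operations.
  P′ : (Fin n → ℚ) → Set
  P′ x = P x × x p ≡ 0ℚ
  c = Fℚ.pivot v zero p vp≢0
  ih = reduce-family P′
    (λ r x (Px , xp≡0) → P-* r x Px , trans (cong (r ℚ.*_) xp≡0) (ℚₚ.*-zeroʳ r))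
    (λ x y (Px , xp≡0) (Py , yp≡0) → P-+ x y Px Py , cong₂ ℚ._+_ xp≡0 yp≡0)
    (Fℚ.shear zero c v)
    (λ a → P-+ (v (suc a)) (λ i → c a ℚ.* v zero i) (Pv (suc a)) (P-* (c a) (v zero) (Pv zero))
         , Fℚ.pivot-vanishes v zero p vp≢0 a)
    (Fℚ.shear-independent zero c {v} ind)
  y′ = proj₁ ih
  y′-ind = proj₁ (proj₂ ih)
  y′-lift = proj₂ (proj₂ ih)
  y : Fin (suc k) → Fin n → Bool
  y zero    = y₀
  y (suc a) = y′ a
  yp≡0 : ∀ a → y′ a p ≡ false
  yp≡0 a = let x , (_ , xp≡0) , x-y = y′-lift a in
    reduces-unique (subst (λ q → Reduces q (y′ a p)) xp≡0 (x-y p)) reduces-0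

-- Eigenvectors modulo 2

sumℚ≡sum : ∀ {k} (f : Fin k → ℚ) → sumℚ f ≡ sumQ f
sumℚ≡sum {zero}  f = refl
sumℚ≡sum {suc k} f = cong (f zero ℚ.+_) (sumℚ≡sum (f ∘ suc))

Eigenvector : ∀ {n} → Mat n → ℚ → (Fin n → ℚ) → Set
Eigenvector M μ x = ∀ i → sumQ (λ j → M i j ℚ.* x j) ≡ μ ℚ.* x i

private
  swap : ∀ p q r → p ℚ.* (q ℚ.* r) ≡ q ℚ.* (p ℚ.* r)
  swap p q r = trans (sym (ℚₚ.*-assoc p q r)) (trans (cong (ℚ._* r) (ℚₚ.*-comm p q)) (ℚₚ.*-assoc q p r))

eigenvector-* : ∀ {n} (M : Mat n) μ q x → Eigenvector M μ x → Eigenvector M μ (λ i → q ℚ.* x i)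
eigenvector-* M μ q x Mx i = begin
  sumQ (λ j → M i j ℚ.* (q ℚ.* x j))    ≡⟨ sum-cong-≗ (λ j → swap (M i j) q (x j)) ⟩
  sumQ (λ j → q ℚ.* (M i j ℚ.* x j))    ≡⟨ *-distribˡ-sum q (λ j → M i j ℚ.* x j) ⟨
  q ℚ.* sumQ (λ j → M i j ℚ.* x j)      ≡⟨ cong (q ℚ.*_) (Mx i) ⟩
  q ℚ.* (μ ℚ.* x i)                     ≡⟨ swap q μ (x i) ⟩
  μ ℚ.* (q ℚ.* x i)                     ∎
  where open ≡-Reasoning

eigenvector-+ : ∀ {n} (M : Mat n) μ x y → Eigenvector M μ x → Eigenvector M μ y →
                Eigenvector M μ (λ i → x i ℚ.+ y i)
eigenvector-+ M μ x y Mx My i = begin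
  sumQ (λ j → M i j ℚ.* (x j ℚ.+ y j))                       ≡⟨ sum-cong-≗ (λ j → ℚₚ.*-distribˡ-+ (M i j) (x j) (y j)) ⟩
  sumQ (λ j → M i j ℚ.* x j ℚ.+ M i j ℚ.* y j)               ≡⟨ ∑-distrib-+ (λ j → M i j ℚ.* x j) (λ j → M i j ℚ.* y j) ⟩
  sumQ (λ j → M i j ℚ.* x j) ℚ.+ sumQ (λ j → M i j ℚ.* y j)  ≡⟨ cong₂ ℚ._+_ (Mx i) (My i) ⟩
  μ ℚ.* x i ℚ.+ μ ℚ.* y i                                    ≡⟨ ℚₚ.*-distribˡ-+ μ (x i) (y i) ⟨
  μ ℚ.* (x i ℚ.+ y i)                                        ∎
  where open ≡-Reasoning

-- Each reduced vector has an integral lift that is still an eigenvector over ℚ. Both sides of its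
-- eigenvalue equation have a residue, and residues are unique.
reduce-eigenfamily : ∀ {n k} {M : Mat n} {μ} (N : Fin n → Fin n → Bool) ν →
  (∀ i j → Reduces (M i j) (N i j)) → Reduces μ ν → EigFamily M μ k →
  ∃ λ (y : Fin k → Fin n → Bool) → F₂.Independent (λ _ → ⊤) y ×
    (∀ a i → sum₂ (λ j → N i j ∧ y a j) ≡ ν ∧ y a i)
reduce-eigenfamily {M = M} {μ} N ν M-N μ-ν record { vec = vec ; inKer = inKer ; indep = indep }
  with y , y-ind , y-lift ← reduce-family (Eigenvector M μ) (eigenvector-* M μ) (eigenvector-+ M μ) vec
         (λ a i → trans (sym (sumℚ≡sum (λ j → M i j ℚ.* vec a j))) (x∙y⁻¹≈ε⇒x≈y _ _ (inKer a i)))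
         (λ c Σ≡0 → indep c (λ i → trans (sumℚ≡sum (λ a → c a ℚ.* vec a i)) (Σ≡0 i tt)))
  = y , y-ind , λ a i → let x , Mx , x-y = y-lift a in
      reduces-unique (reduces-sum (λ j → reduces-* (M-N i j) (x-y j)))
        (subst (λ q → Reduces q (ν ∧ y a i)) (sym (Mx i)) (reduces-* μ-ν (x-y i)))

-- Sums over vertices, edges and cycles

sumOver : ∀ {I : Set} → List I → (I → Bool) → Bool
sumOver l h = sum₂ (λ j → h (lookup l j))

sumOver-++ : ∀ {I : Set} (l m : List I) h → sumOver (l ++ m) h ≡ sumOver l h xor sumOver m h
sumOver-++ []      m h = refl
sumOver-++ (i ∷ l) m h = trans (cong (h i xor_) (sumOver-++ l m h)) (sym (𝔹ₚ.xor-assoc (h i) _ _))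

-- Coordinates are collected in lists so that their number comes out as the very `count` that the
-- graph invariants are defined by.
select : ∀ {I : Set} {k} → (Fin k → Bool) → (Fin k → I) → List I
select {k = zero}  p g = []
select {k = suc k} p g = (if p zero then g zero ∷ [] else []) ++ select (p ∘ suc) (g ∘ suc)

length-select : ∀ {I : Set} {k} (p : Fin k → Bool) (g : Fin k → I) → length (select p g) ≡ count p
length-select {k = zero}  p g = refl
length-select {k = suc k} p g with p zero
... | true  = cong suc (length-select (p ∘ suc) (g ∘ suc))
... | false = length-select (p ∘ suc) (g ∘ suc)

∈-select : ∀ {I : Set} {k} (p : Fin k → Bool) (g : Fin k → I) i → p i ≡ true → g i ∈ select p g
∈-select p g zero    p0≡1 rewrite p0≡1 = here refl
∈-select p g (suc i) pi≡1 = ∈-++⁺ʳ (if p zero then g zero ∷ [] else []) (∈-select (p ∘ suc) (g ∘ suc) i pi≡1)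

sumOver-select : ∀ {I : Set} {k} (p : Fin k → Bool) (g : Fin k → I) h →
                 sumOver (select p g) h ≡ sum₂ (λ i → p i ∧ h (g i))
sumOver-select {k = zero}  p g h = refl
sumOver-select {k = suc k} p g h with p zero
... | true  = cong (h (g zero) xor_) (sumOver-select (p ∘ suc) (g ∘ suc) h)
... | false = sumOver-select (p ∘ suc) (g ∘ suc) h

gather : ∀ {I : Set} {k} → (Fin k → List I) → List I
gather ls = concat (tabulate ls)

length-gather : ∀ {I : Set} {k} (ls : Fin k → List I) → length (gather ls) ≡ sumℕ (length ∘ ls)
length-gather {k = zero}  ls = refl
length-gather {k = suc k} ls =
  trans (Listₚ.length-++ (ls zero)) (cong (length (ls zero) ℕ.+_) (length-gather (ls ∘ suc)))

∈-gather : ∀ {I : Set} {k} (ls : Fin k → List I) u {i} → i ∈ ls u → i ∈ gather ls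
∈-gather ls zero    i∈l = ∈-++⁺ˡ i∈l
∈-gather ls (suc u) i∈l = ∈-++⁺ʳ (ls zero) (∈-gather (ls ∘ suc) u i∈l)

sumOver-gather : ∀ {I : Set} {k} (ls : Fin k → List I) h → sumOver (gather ls) h ≡ sum₂ (λ u → sumOver (ls u) h)
sumOver-gather {k = zero}  ls h = refl
sumOver-gather {k = suc k} ls h =
  trans (sumOver-++ (ls zero) _ h) (cong (sumOver (ls zero) h xor_) (sumOver-gather (ls ∘ suc) h))

sumℕ-cong : ∀ {k} {f g : Fin k → ℕ} → (∀ i → f i ≡ g i) → sumℕ f ≡ sumℕ g
sumℕ-cong {zero}  f≡g = refl
sumℕ-cong {suc k} f≡g = cong₂ ℕ._+_ (f≡g zero) (sumℕ-cong (f≡g ∘ suc))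

xorSum≡sum₂ : ∀ {k} (f : Fin k → Bool) → xorSum f ≡ sum₂ f
xorSum≡sum₂ {zero}  f = refl
xorSum≡sum₂ {suc k} f = cong (f zero xor_) (xorSum≡sum₂ (f ∘ suc))

odd-count : ∀ {k} (p : Fin k → Bool) → odd (count p) ≡ sum₂ p
odd-count {zero}  p = refl
odd-count {suc k} p with p zero
... | true  = cong not (odd-count (p ∘ suc))
... | false = odd-count (p ∘ suc)

odd≡¬even : ∀ m → odd m ≡ not (isEven m)
odd≡¬even zero          = refl
odd≡¬even (suc zero)    = refl
odd≡¬even (suc (suc m)) = trans (𝔹ₚ.not-involutive (odd m)) (odd≡¬even m)

∧-true : ∀ {a b} → a ∧ b ≡ true → a ≡ true × b ≡ true
∧-true {true} b≡1 = refl , b≡1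

sum₂-true : ∀ k → sum₂ {k} (λ _ → true) ≡ odd k
sum₂-true zero    = refl
sum₂-true (suc k) = cong not (sum₂-true k)

eqFin-refl : ∀ {k} (u : Fin k) → eqFin u u ≡ true
eqFin-refl zero    = refl
eqFin-refl (suc u) = eqFin-refl u

eqFin⇒≡ : ∀ {k} (u v : Fin k) → eqFin u v ≡ true → u ≡ v
eqFin⇒≡ zero    zero    _ = refl
eqFin⇒≡ (suc u) (suc v) p = cong suc (eqFin⇒≡ u v p)

sum₂-eqFin : ∀ {k} v (h : Fin k → Bool) → sum₂ (λ u → eqFin v u ∧ h u) ≡ h v
sum₂-eqFin {suc k} zero h = trans (cong (h zero xor_) (sum₂-false {k} (λ _ → false) (λ _ → refl))) (𝔹ₚ.xor-identityʳ (h zero))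
sum₂-eqFin {suc k} (suc v) h = sum₂-eqFin v (h ∘ suc)

private
  trichotomy : ∀ a b → (a <ᵇ b) xor ((b <ᵇ a) xor (a ≡ᵇ b)) ≡ true
  trichotomy zero    zero    = refl
  trichotomy zero    (suc b) = refl
  trichotomy (suc a) zero    = refl
  trichotomy (suc a) (suc b) = trichotomy a b

-- The pairs u < v and v < u are summed together; the diagonal does not contribute.
sum₂-pairs : ∀ {k} (g : Fin k → Fin k → Bool) → (∀ u → g u u ≡ false) →
  sum₂ (λ u → sum₂ (λ v → g u v)) ≡ sum₂ (λ u → sum₂ (λ v → (toℕ u <ᵇ toℕ v) ∧ (g u v xor g v u)))
sum₂-pairs g diag = begin
  sum₂ (λ u → sum₂ (λ v → g u v))
    ≡⟨ sum₂-cong (λ u → trans (sum₂-cong (split u)) (sum₂-xor (λ v → lt u v ∧ g u v) (λ v → lt v u ∧ g u v))) ⟩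
  sum₂ (λ u → sum₂ (λ v → lt u v ∧ g u v) xor sum₂ (λ v → lt v u ∧ g u v))
    ≡⟨ sum₂-xor (λ u → sum₂ (λ v → lt u v ∧ g u v)) (λ u → sum₂ (λ v → lt v u ∧ g u v)) ⟩
  sum₂ (λ u → sum₂ (λ v → lt u v ∧ g u v)) xor sum₂ (λ u → sum₂ (λ v → lt v u ∧ g u v))
    ≡⟨ cong (sum₂ (λ u → sum₂ (λ v → lt u v ∧ g u v)) xor_) (sum₂-comm (λ u v → lt v u ∧ g u v)) ⟩
  sum₂ (λ u → sum₂ (λ v → lt u v ∧ g u v)) xor sum₂ (λ u → sum₂ (λ v → lt u v ∧ g v u))
    ≡⟨ sum₂-xor (λ u → sum₂ (λ v → lt u v ∧ g u v)) (λ u → sum₂ (λ v → lt u v ∧ g v u)) ⟨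
  sum₂ (λ u → sum₂ (λ v → lt u v ∧ g u v) xor sum₂ (λ v → lt u v ∧ g v u))
    ≡⟨ sum₂-cong (λ u → trans (sym (sum₂-xor (λ v → lt u v ∧ g u v) (λ v → lt u v ∧ g v u)))
         (sum₂-cong (λ v → sym (𝔹ₚ.∧-distribˡ-xor (lt u v) (g u v) (g v u))))) ⟩
  sum₂ (λ u → sum₂ (λ v → lt u v ∧ (g u v xor g v u))) ∎
  where
  open ≡-Reasoning
  lt : ∀ u v → Bool
  lt u v = toℕ u <ᵇ toℕ v
  split : ∀ u v → g u v ≡ (lt u v ∧ g u v) xor (lt v u ∧ g u v)
  split u v with eqFin u v in eq | trichotomy (toℕ u) (toℕ v)
  ... | true  | _ with refl ← eqFin⇒≡ u v eq rewrite diag u | 𝔹ₚ.∧-zeroʳ (lt u u) = refl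
  ... | false | tri = trans (cong (_∧ g u v) (trans (sym tri) (cong (lt u v xor_) (𝔹ₚ.xor-identityʳ (lt v u)))))
                            (𝔹ₚ.∧-distribʳ-xor (g u v) (lt u v) (lt v u))

sum₂-telescope : ∀ {k} (h : Fin (suc k) → Bool) →
                 sum₂ (λ i → h (inject₁ i) xor h (suc i)) ≡ h zero xor h (fromℕ k)
sum₂-telescope {zero}  h = sym (𝔹ₚ.xor-same (h zero))
sum₂-telescope {suc k} h = trans (cong ((h zero xor h (suc zero)) xor_) (sum₂-telescope (h ∘ suc)))
  (cancel (h zero) (h (suc zero)) (h (fromℕ (suc k))))
  where
  cancel : ∀ a b c → (a xor b) xor (b xor c) ≡ a xor c
  cancel a true  c = trans (𝔹ₚ.xor-assoc a true (not c)) (cong (a xor_) (𝔹ₚ.not-involutive c))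
  cancel a false c = cong (_xor c) (𝔹ₚ.xor-identityʳ a)

-- Green's identity and the edge sets of odd cycles

module _ (G : Graph) where
  private
    V : Set
    V = Fin (n G)

  LocallyConstant : (V → Bool) → Set
  LocallyConstant x = ∀ u v → adj G u v ≡ true → x u ≡ x v

  -- This is D + A over 𝔽₂, written as the parity of the number of edges at `u` cut by `x`: the form
  -- in which cuts appear directly.
  laplacian : (V → Bool) → V → Bool
  laplacian x u = sum₂ (λ v → adj G u v ∧ (x u xor x v))

  edgeSum : (V → V → Bool) → Bool
  edgeSum h = sum₂ (λ u → sum₂ (λ v → (adj G u v ∧ (toℕ u <ᵇ toℕ v)) ∧ h u v))

  -- Each edge is listed once, whereas arcs see both of its directions; `a u v xor a v u` forgets
  -- the direction. Taking `a` to be a vertex function of the first end gives Green's identity,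
  -- taking the arcs of a walk gives summation along it.
  edgeSum-arcs : (h a : V → V → Bool) → (∀ u v → h u v ≡ h v u) →
    edgeSum (λ u v → h u v ∧ (a u v xor a v u)) ≡ sum₂ (λ u → sum₂ (λ v → adj G u v ∧ (h u v ∧ a u v)))
  edgeSum-arcs h a h-sym = sym (trans
    (sum₂-pairs (λ u v → adj G u v ∧ (h u v ∧ a u v)) (λ u → cong (_∧ (h u u ∧ a u u)) (loopless G u)))
    (sum₂-cong λ u → sum₂-cong λ v → pair u v))
    where
    pair : ∀ u v → (toℕ u <ᵇ toℕ v) ∧ ((adj G u v ∧ (h u v ∧ a u v)) xor (adj G v u ∧ (h v u ∧ a v u)))
                 ≡ (adj G u v ∧ (toℕ u <ᵇ toℕ v)) ∧ (h u v ∧ (a u v xor a v u))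
    pair u v rewrite adj-sym G v u | h-sym v u =
      solve 5 (λ l e h a b → l :* (e :* (h :* a) :+ e :* (h :* b)) := e :* l :* (h :* (a :+ b))) refl
        (toℕ u <ᵇ toℕ v) (adj G u v) (h u v) (a u v) (a v u)
      where open xor-∧-Solver

  -- The transpose of the coboundary composed with the coboundary is the Laplacian. With `c` a
  -- single vertex, the left side pairs the star of that vertex with the cut of `x`.
  green : ∀ (c x : V → Bool) → edgeSum (λ u v → (c u xor c v) ∧ (x u xor x v)) ≡ sum₂ (λ u → c u ∧ laplacian x u)
  green c x = begin
    edgeSum (λ u v → (c u xor c v) ∧ (x u xor x v))
      ≡⟨ sum₂-cong (λ u → sum₂-cong (λ v → cong ((adj G u v ∧ (toℕ u <ᵇ toℕ v)) ∧_)
           (𝔹ₚ.∧-comm (c u xor c v) (x u xor x v)))) ⟩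
    edgeSum (λ u v → (x u xor x v) ∧ (c u xor c v))
      ≡⟨ edgeSum-arcs (λ u v → x u xor x v) (λ u v → c u) (λ u v → 𝔹ₚ.xor-comm (x u) (x v)) ⟩
    sum₂ (λ u → sum₂ (λ v → adj G u v ∧ ((x u xor x v) ∧ c u)))
      ≡⟨ sum₂-cong (λ u → trans
           (sum₂-cong (λ v → trans (sym (𝔹ₚ.∧-assoc (adj G u v) (x u xor x v) (c u))) (𝔹ₚ.∧-comm _ (c u))))
           (sym (∧-distribˡ-sum₂ (c u) (λ v → adj G u v ∧ (x u xor x v))))) ⟩
    sum₂ (λ u → c u ∧ laplacian x u) ∎
    where open ≡-Reasoning

  cycleSum : OddCycle G → (V → V → Bool) → Bool
  cycleSum C h = sum₂ (λ i → h (walk C (inject₁ i)) (walk C (suc i)))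

  cycleSum-coboundary : ∀ C x → cycleSum C (λ u v → x u xor x v) ≡ false
  cycleSum-coboundary C x = trans (sum₂-telescope (x ∘ walk C))
    (trans (cong (λ v → x (walk C zero) xor x v) (sym (closed C))) (𝔹ₚ.xor-same (x (walk C zero))))

  arcs : OddCycle G → V → V → Bool
  arcs C u v = cycleSum C (λ u′ v′ → eqFin u′ u ∧ eqFin v′ v)

  -- The edge set of `C` modulo 2: `arcs` has the parity of the traversals from `u` to `v`, and
  -- adding both directions makes it undirected.
  χ : OddCycle G → V → V → Bool
  χ C u v = arcs C u v xor arcs C v u

  χ-sym : ∀ C u v → χ C u v ≡ χ C v u
  χ-sym C u v = 𝔹ₚ.xor-comm (arcs C u v) (arcs C v u)

  -- After exchanging the sums, the Kronecker deltas in `arcs` leave exactly the ends of each step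
  -- of the walk, and these are adjacent. Pairing with the edge set thereby becomes summation along
  -- the walk.
  edgeSum-χ : ∀ C h → (∀ u v → h u v ≡ h v u) → edgeSum (λ u v → h u v ∧ χ C u v) ≡ cycleSum C h
  edgeSum-χ C h h-sym = begin
    edgeSum (λ u v → h u v ∧ χ C u v)
      ≡⟨ edgeSum-arcs h (arcs C) h-sym ⟩
    sum₂ (λ u → sum₂ (λ v → adj G u v ∧ (h u v ∧ arcs C u v)))
      ≡⟨ sum₂-cong (λ u → trans (sum₂-cong (λ v → expand u v)) (sum₂-comm (λ v i → term i u v))) ⟩
    sum₂ (λ u → sum₂ (λ i → sum₂ (λ v → term i u v)))
      ≡⟨ sum₂-comm (λ u i → sum₂ (λ v → term i u v)) ⟩
    sum₂ (λ i → sum₂ (λ u → sum₂ (λ v → term i u v)))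
      ≡⟨ sum₂-cong collapse ⟩
    cycleSum C h ∎
    where
    open ≡-Reasoning
    p q : Fin (len C) → V
    p i = walk C (inject₁ i)
    q i = walk C (suc i)
    term : Fin (len C) → V → V → Bool
    term i u v = eqFin (p i) u ∧ (eqFin (q i) v ∧ (adj G u v ∧ h u v))
    rearrange : ∀ a b c d → (a ∧ b) ∧ (c ∧ d) ≡ c ∧ (d ∧ (a ∧ b))
    rearrange = solve 4 (λ a b c d → a :* b :* (c :* d) := c :* (d :* (a :* b))) refl
      where open xor-∧-Solver
    expand : ∀ u v → adj G u v ∧ (h u v ∧ arcs C u v) ≡ sum₂ (λ i → term i u v)
    expand u v = trans (sym (𝔹ₚ.∧-assoc (adj G u v) (h u v) (arcs C u v)))
      (trans (∧-distribˡ-sum₂ (adj G u v ∧ h u v) (λ i → eqFin (p i) u ∧ eqFin (q i) v))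
             (sum₂-cong (λ i → rearrange (adj G u v) (h u v) (eqFin (p i) u) (eqFin (q i) v))))
    collapse : ∀ i → sum₂ (λ u → sum₂ (λ v → term i u v)) ≡ h (p i) (q i)
    collapse i = begin
      sum₂ (λ u → sum₂ (λ v → term i u v))
        ≡⟨ sum₂-cong (λ u → sym (∧-distribˡ-sum₂ (eqFin (p i) u) (λ v → eqFin (q i) v ∧ (adj G u v ∧ h u v)))) ⟩
      sum₂ (λ u → eqFin (p i) u ∧ sum₂ (λ v → eqFin (q i) v ∧ (adj G u v ∧ h u v)))
        ≡⟨ sum₂-eqFin (p i) (λ u → sum₂ (λ v → eqFin (q i) v ∧ (adj G u v ∧ h u v))) ⟩
      sum₂ (λ v → eqFin (q i) v ∧ (adj G (p i) v ∧ h (p i) v))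
        ≡⟨ sum₂-eqFin (q i) (λ v → adj G (p i) v ∧ h (p i) v) ⟩
      adj G (p i) (q i) ∧ h (p i) (q i)
        ≡⟨ cong (_∧ h (p i) (q i)) (adjs C i) ⟩
      h (p i) (q i) ∎

  -- Oddness of the cycle enters here. Since squaring is the identity on 𝔽₂, the product of χ with
  -- itself equals its product with the constant 1, which is the parity of the length.
  cycleSum-self : ∀ C → cycleSum C (χ C) ≡ true
  cycleSum-self C = begin
    cycleSum C (χ C)
      ≡⟨ edgeSum-χ C (χ C) (χ-sym C) ⟨
    edgeSum (λ u v → χ C u v ∧ χ C u v)
      ≡⟨ sum₂-cong (λ u → sum₂-cong (λ v → cong ((adj G u v ∧ (toℕ u <ᵇ toℕ v)) ∧_) (𝔹ₚ.∧-idem (χ C u v)))) ⟩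
    edgeSum (λ u v → true ∧ χ C u v)
      ≡⟨ edgeSum-χ C (λ _ _ → true) (λ _ _ → refl) ⟩
    sum₂ {len C} (λ _ → true)
      ≡⟨ sum₂-true (len C) ⟩
    odd (len C)
      ≡⟨ odd≡¬even (len C) ⟩
    not (isEven (len C))
      ≡⟨ cong not (oddLen C) ⟩
    true ∎
    where open ≡-Reasoning

  -- Any nonzero term would exhibit a common edge; the two summands of χ match the two orientations
  -- allowed in `SameEdge`.
  cycleSum-disjoint : ∀ C D → EdgeDisjoint C D → cycleSum D (χ C) ≡ false
  cycleSum-disjoint C D disjoint = sum₂-false _ λ j → cong₂ _xor_
    (sum₂-false _ λ i → 𝔹ₚ.¬-not λ eq → let a , b = ∧-true eq in
      disjoint i j (inj₁ (eqFin⇒≡ _ _ a , eqFin⇒≡ _ _ b)))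
    (sum₂-false _ λ i → 𝔹ₚ.¬-not λ eq → let a , b = ∧-true eq in
      disjoint i j (inj₂ (eqFin⇒≡ _ _ a , eqFin⇒≡ _ _ b)))

-- Dimension count for cuts and odd cycles

eqFin-sym : ∀ {k} (u v : Fin k) → eqFin u v ≡ eqFin v u
eqFin-sym zero    zero    = refl
eqFin-sym zero    (suc v) = refl
eqFin-sym (suc u) zero    = refl
eqFin-sym (suc u) (suc v) = eqFin-sym u v

comb-eqFin : ∀ {m} (c : Fin m → Bool) u → comb₂ c eqFin u ≡ c u
comb-eqFin c u = trans (sum₂-cong (λ v → trans (𝔹ₚ.∧-comm (c v) (eqFin v u)) (cong (_∧ c v) (eqFin-sym v u))))
                       (sum₂-eqFin u c)

xor-false⇒≡ : ∀ a b → a xor b ≡ false → a ≡ b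
xor-false⇒≡ true  true  _ = refl
xor-false⇒≡ false false _ = refl

comb-false : ∀ {m} (c : Fin m → Bool) → sum₂ (λ a → c a ∧ false) ≡ false
comb-false c = sum₂-false _ (λ a → 𝔹ₚ.∧-zeroʳ (c a))

∧-swap : ∀ a b c → a ∧ (b ∧ c) ≡ b ∧ (a ∧ c)
∧-swap a b c = trans (sym (𝔹ₚ.∧-assoc a b c)) (trans (cong (_∧ c) (𝔹ₚ.∧-comm a b)) (𝔹ₚ.∧-assoc b a c))

-- A vertex set x is recorded by δx on the edges, by x on the mask s (which corrects for
-- (D + A) x = s x) and by x on the mask r (which detects the x with δx = 0).  The vertex
-- functionals live on a second copy inR′ of r instead: there the vectors x vanish, so all n
-- functionals are orthogonal to them, and independent, at the cost of count r more dimensions.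
data Coordinate (V : Set) : Set where
  edge       : V → V → Coordinate V
  inS inR inR′ : V → Coordinate V

module _ (G : Graph) where
  private
    V : Set
    V = Fin (n G)

  -- The locally constant functions are the kernel of the coboundary, so this says that δx together
  -- with the values of x on the two masks determines x.
  Rigid : (s r : V → Bool) → Set
  Rigid s r = ∀ x → LocallyConstant G x → (∀ v → s v ≡ true → x v ≡ false) →
              (∀ v → r v ≡ true → x v ≡ false) → ∀ v → x v ≡ false

  primal dual : (V → Bool) → Coordinate V → Bool
  primal x (edge u v) = x u xor x v
  primal x (inS v)    = x v
  primal x (inR v)    = x v
  primal x (inR′ v)   = false
  dual x (edge u v) = x u xor x v
  dual x (inS v)    = x v
  dual x (inR v)    = false
  dual x (inR′ v)   = x v

  cyclic : OddCycle G → Coordinate V → Bool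
  cyclic C (edge u v) = χ G C u v
  cyclic C (inS v)    = false
  cyclic C (inR v)    = false
  cyclic C (inR′ v)   = false

  comb-coboundary : ∀ {m} c (x : Fin m → V → Bool) u v →
    sum₂ (λ a → c a ∧ (x a u xor x a v)) ≡ comb₂ c x u xor comb₂ c x v
  comb-coboundary c x u v = trans (sum₂-cong (λ a → 𝔹ₚ.∧-distribˡ-xor (c a) (x a u) (x a v)))
    (sum₂-xor (λ a → c a ∧ x a u) (λ a → c a ∧ x a v))

  comb-primal : ∀ {m} c (x : Fin m → V → Bool) i → comb₂ c (primal ∘ x) i ≡ primal (comb₂ c x) i
  comb-primal c x (edge u v) = comb-coboundary c x u v
  comb-primal c x (inS v)    = refl
  comb-primal c x (inR v)    = refl
  comb-primal c x (inR′ v)   = comb-false c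

  comb-dual : ∀ {m} c (x : Fin m → V → Bool) i → comb₂ c (dual ∘ x) i ≡ dual (comb₂ c x) i
  comb-dual c x (edge u v) = comb-coboundary c x u v
  comb-dual c x (inS v)    = refl
  comb-dual c x (inR v)    = comb-false c
  comb-dual c x (inR′ v)   = refl

  -- The coordinate list holds each edge only in the order `u` < `v`; a symmetric property known
  -- there extends to both orders.
  adjacent-ordered : (P : V → V → Set) → (∀ u v → P u v → P v u) →
    (∀ u v → adj G u v ≡ true → (toℕ u <ᵇ toℕ v) ≡ true → P u v) → ∀ u v → adj G u v ≡ true → P u v
  adjacent-ordered P P-sym P-< u v uv with ℕₚ.<-cmp (toℕ u) (toℕ v)
  ... | tri< u<v _ _ = P-< u v uv (Equivalence.to 𝔹ₚ.T-≡ (ℕₚ.<⇒<ᵇ u<v))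
  ... | tri> _ _ v<u = P-sym v u (P-< v u (trans (adj-sym G v u) uv) (Equivalence.to 𝔹ₚ.T-≡ (ℕₚ.<⇒<ᵇ v<u)))
  ... | tri≈ _ u≡v _ with refl ← Finₚ.toℕ-injective u≡v = contradiction (trans (sym uv) (loopless G u)) λ ()

  module _ (s r : V → Bool) (rigid : Rigid s r) where

    edges coordinates : List (Coordinate V)
    edges = gather (λ u → select (λ v → adj G u v ∧ (toℕ u <ᵇ toℕ v)) (edge u))
    coordinates = edges ++ (select s inS ++ (select r inR ++ select r inR′))

    length-coordinates : length coordinates ≡ nE G ℕ.+ (count s ℕ.+ (count r ℕ.+ count r))
    length-coordinates = trans (Listₚ.length-++ edges) (cong₂ ℕ._+_
      (trans (length-gather (λ u → select (λ v → adj G u v ∧ (toℕ u <ᵇ toℕ v)) (edge u)))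
             (sumℕ-cong (λ u → length-select (λ v → adj G u v ∧ (toℕ u <ᵇ toℕ v)) (edge u))))
      (trans (Listₚ.length-++ (select s inS)) (cong₂ ℕ._+_ (length-select s inS)
        (trans (Listₚ.length-++ (select r inR)) (cong₂ ℕ._+_ (length-select r inR) (length-select r inR′))))))

    sumOver-coordinates : ∀ h → sumOver coordinates h ≡
      edgeSum G (λ u v → h (edge u v)) xor
      (sum₂ (λ v → s v ∧ h (inS v)) xor (sum₂ (λ v → r v ∧ h (inR v)) xor sum₂ (λ v → r v ∧ h (inR′ v))))
    sumOver-coordinates h = trans (sumOver-++ edges _ h) (cong₂ _xor_
      (trans (sumOver-gather (λ u → select (λ v → adj G u v ∧ (toℕ u <ᵇ toℕ v)) (edge u)) h)
             (sum₂-cong (λ u → sumOver-select (λ v → adj G u v ∧ (toℕ u <ᵇ toℕ v)) (edge u) h)))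
      (trans (sumOver-++ (select s inS) _ h) (cong₂ _xor_ (sumOver-select s inS h)
        (trans (sumOver-++ (select r inR) _ h) (cong₂ _xor_ (sumOver-select r inR h) (sumOver-select r inR′ h))))))

    edge∈ : ∀ u v → adj G u v ≡ true → (toℕ u <ᵇ toℕ v) ≡ true → edge u v ∈ coordinates
    edge∈ u v uv u<v = ∈-++⁺ˡ (∈-gather (λ u → select (λ v → adj G u v ∧ (toℕ u <ᵇ toℕ v)) (edge u)) u
      (∈-select (λ v → adj G u v ∧ (toℕ u <ᵇ toℕ v)) (edge u) v (cong₂ _∧_ uv u<v)))

    inS∈ : ∀ v → s v ≡ true → inS v ∈ coordinates
    inS∈ v sv = ∈-++⁺ʳ edges (∈-++⁺ˡ (∈-select s inS v sv))

    inR∈ : ∀ v → r v ≡ true → inR v ∈ coordinates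
    inR∈ v rv = ∈-++⁺ʳ edges (∈-++⁺ʳ (select s inS) (∈-++⁺ˡ (∈-select r inR v rv)))

    inR′∈ : ∀ v → r v ≡ true → inR′ v ∈ coordinates
    inR′∈ v rv = ∈-++⁺ʳ edges (∈-++⁺ʳ (select s inS) (∈-++⁺ʳ (select r inR) (∈-select r inR′ v rv)))

    dual-injective : ∀ x → (∀ i → i ∈ coordinates → dual x i ≡ false) → ∀ v → x v ≡ false
    dual-injective x x≡0 = rigid x
      (adjacent-ordered (λ u v → x u ≡ x v) (λ _ _ → sym)
        (λ u v uv u<v → xor-false⇒≡ (x u) (x v) (x≡0 (edge u v) (edge∈ u v uv u<v))))
      (λ v sv → x≡0 (inS v) (inS∈ v sv))
      (λ v rv → x≡0 (inR′ v) (inR′∈ v rv))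

    -- The combination of the single-vertex functionals with coefficients `c` is `dual c` itself, so
    -- their independence is the injectivity of `dual`.
    dual-independent : Independent₂ (_∈ coordinates) (λ v → dual (eqFin v))
    dual-independent c Σ≡0 = dual-injective c λ i i∈ → trans
      (trans (dual-cong (λ u → sym (comb-eqFin c u)) i) (sym (comb-dual c eqFin i))) (Σ≡0 i i∈)
      where
      dual-cong : ∀ {x y} → (∀ u → x u ≡ y u) → ∀ i → dual x i ≡ dual y i
      dual-cong x≡y (edge u v) = cong₂ _xor_ (x≡y u) (x≡y v)
      dual-cong x≡y (inS v)    = x≡y v
      dual-cong x≡y (inR v)    = refl
      dual-cong x≡y (inR′ v)   = x≡y v

    -- Summing the relation along the q-th cycle isolates `d q`: a coboundary sums to zero around a
    -- closed walk, and the cycles are orthonormal. Once the cycles are gone, rigidity forces x to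
    -- vanish.
    primal+cyclic-injective : ∀ {t} (D : DisjOddCycles G t) (x : V → Bool) d →
      (∀ i → i ∈ coordinates → primal x i xor comb₂ d (cyclic ∘ DisjOddCycles.cyc D) i ≡ false) →
      (∀ v → x v ≡ false) × (∀ q → d q ≡ false)
    primal+cyclic-injective D x d Σ≡0 = x≡0 , d≡0
      where
      open DisjOddCycles D
      open ≡-Reasoning
      h : V → V → Bool
      h u v = (x u xor x v) xor sum₂ (λ p → d p ∧ χ G (cyc p) u v)
      h-sym : ∀ u v → h u v ≡ h v u
      h-sym u v = cong₂ _xor_ (𝔹ₚ.xor-comm (x u) (x v)) (sum₂-cong (λ p → cong (d p ∧_) (χ-sym G (cyc p) u v)))
      h≡0 : ∀ u v → adj G u v ≡ true → h u v ≡ false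
      h≡0 = adjacent-ordered (λ u v → h u v ≡ false) (λ u v → trans (h-sym v u))
        (λ u v uv u<v → Σ≡0 (edge u v) (edge∈ u v uv u<v))
      χ-orthonormal : ∀ p q → cycleSum G (cyc q) (χ G (cyc p)) ≡ eqFin p q
      χ-orthonormal p q with eqFin p q in eq
      ... | true  with refl ← eqFin⇒≡ p q eq = cycleSum-self G (cyc p)
      ... | false = cycleSum-disjoint G (cyc p) (cyc q) (disj p q
              λ { refl → contradiction (trans (sym eq) (eqFin-refl p)) λ () })
      d≡0 : ∀ q → d q ≡ false
      d≡0 q = begin
        d q
          ≡⟨ comb-eqFin d q ⟨
        sum₂ (λ p → d p ∧ eqFin p q)
          ≡⟨ sum₂-cong (λ p → trans (cong (d p ∧_) (sym (χ-orthonormal p q)))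
                                    (∧-distribˡ-sum₂ (d p) (λ i → χ G (cyc p) (walk C (inject₁ i)) (walk C (suc i))))) ⟩
        sum₂ (λ p → cycleSum G C (λ u v → d p ∧ χ G (cyc p) u v))
          ≡⟨ sum₂-comm (λ p i → d p ∧ χ G (cyc p) (walk C (inject₁ i)) (walk C (suc i))) ⟩
        cycleSum G C (λ u v → sum₂ (λ p → d p ∧ χ G (cyc p) u v))
          ≡⟨ cong (_xor cycleSum G C (λ u v → sum₂ (λ p → d p ∧ χ G (cyc p) u v))) (cycleSum-coboundary G C x) ⟨
        cycleSum G C (λ u v → x u xor x v) xor cycleSum G C (λ u v → sum₂ (λ p → d p ∧ χ G (cyc p) u v))
          ≡⟨ sum₂-xor (λ i → x (walk C (inject₁ i)) xor x (walk C (suc i)))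
                      (λ i → sum₂ (λ p → d p ∧ χ G (cyc p) (walk C (inject₁ i)) (walk C (suc i)))) ⟨
        cycleSum G C h
          ≡⟨ sum₂-false _ (λ i → h≡0 _ _ (adjs C i)) ⟩
        false ∎
        where C = cyc q
      primal≡0 : ∀ i → i ∈ coordinates → primal x i ≡ false
      primal≡0 i i∈ = begin
        primal x i
          ≡⟨ 𝔹ₚ.xor-identityʳ (primal x i) ⟨
        primal x i xor false
          ≡⟨ cong (primal x i xor_) (sum₂-false _ (λ p → cong (_∧ cyclic (cyc p) i) (d≡0 p))) ⟨
        primal x i xor comb₂ d (cyclic ∘ cyc) i
          ≡⟨ Σ≡0 i i∈ ⟩
        false ∎
      x≡0 : ∀ v → x v ≡ false
      x≡0 = rigid x
        (adjacent-ordered (λ u v → x u ≡ x v) (λ _ _ → sym)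
          (λ u v uv u<v → xor-false⇒≡ (x u) (x v) (primal≡0 (edge u v) (edge∈ u v uv u<v))))
        (λ v sv → primal≡0 (inS v) (inS∈ v sv))
        (λ v rv → primal≡0 (inR v) (inR∈ v rv))

    dual⊥cyclic : ∀ c C → F₂.dot coordinates (dual c) (cyclic C) ≡ false
    dual⊥cyclic c C = begin
      F₂.dot coordinates (dual c) (cyclic C)
        ≡⟨ sumOver-coordinates (λ i → dual c i ∧ cyclic C i) ⟩
      edgeSum G (λ u v → (c u xor c v) ∧ χ G C u v) xor
        (sum₂ (λ v → s v ∧ (c v ∧ false)) xor (sum₂ (λ v → r v ∧ false) xor sum₂ (λ v → r v ∧ (c v ∧ false))))
        ≡⟨ cong₂ _xor_
             (trans (edgeSum-χ G C (λ u v → c u xor c v) (λ u v → 𝔹ₚ.xor-comm (c u) (c v))) (cycleSum-coboundary G C c))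
             (cong₂ _xor_ (∧∧false s) (cong₂ _xor_ (comb-false r) (∧∧false r))) ⟩
      false ∎
      where
      open ≡-Reasoning
      ∧∧false : ∀ (p : V → Bool) → sum₂ (λ v → p v ∧ (c v ∧ false)) ≡ false
      ∧∧false p = sum₂-false _ (λ v → trans (cong (p v ∧_) (𝔹ₚ.∧-zeroʳ (c v))) (𝔹ₚ.∧-zeroʳ (p v)))

    -- By Green's identity the edges contribute Σ c · Lx, which the hypothesis turns into the sum of
    -- c · x over `s`. The `inS` block contributes the same sum, so the two cancel in characteristic
    -- 2; on `inR` and `inR′` one of the two vectors is zero.
    dual⊥primal : ∀ c x → (∀ u → laplacian G x u ≡ s u ∧ x u) → F₂.dot coordinates (dual c) (primal x) ≡ false
    dual⊥primal c x Lx≡sx = begin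
      F₂.dot coordinates (dual c) (primal x)
        ≡⟨ sumOver-coordinates (λ i → dual c i ∧ primal x i) ⟩
      edgeSum G (λ u v → (c u xor c v) ∧ (x u xor x v)) xor
        (S xor (sum₂ (λ v → r v ∧ false) xor sum₂ (λ v → r v ∧ (c v ∧ false))))
        ≡⟨ cong₂ _xor_ (trans (green G c x) (sum₂-cong λ u → trans (cong (c u ∧_) (Lx≡sx u)) (∧-swap (c u) (s u) (x u))))
             (trans (cong (S xor_) (cong₂ _xor_ (comb-false r)
               (sum₂-false _ (λ v → trans (cong (r v ∧_) (𝔹ₚ.∧-zeroʳ (c v))) (𝔹ₚ.∧-zeroʳ (r v))))))
               (𝔹ₚ.xor-identityʳ S)) ⟩
      S xor S
        ≡⟨ 𝔹ₚ.xor-same S ⟩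
      false ∎
      where
      open ≡-Reasoning
      S = sum₂ (λ v → s v ∧ (c v ∧ x v))

    -- The n functionals `dual (eqFin v)` are set against the k eigenvectors and t cycles. The right
    -- side is the number of coordinates, in which `r` counts twice because it has two copies.
    laplacian-bound : ∀ {k t} (x : Fin k → V → Bool) → Independent₂ (λ _ → ⊤) x →
      (∀ a u → laplacian G (x a) u ≡ s u ∧ x a u) → DisjOddCycles G t →
      n G ℕ.+ (k ℕ.+ t) ℕ.≤ nE G ℕ.+ (count s ℕ.+ (count r ℕ.+ count r))
    laplacian-bound {k} {t} x x-ind Lx≡sx D = subst (n G ℕ.+ (k ℕ.+ t) ℕ.≤_) length-coordinates
      (F₂.orthogonal-bound coordinates (λ v → dual (eqFin v)) U dual-independent U-independent orthogonal)
      where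
      open DisjOddCycles D
      U : Fin (k ℕ.+ t) → Coordinate V → Bool
      U = (primal ∘ x) Vec.++ (cyclic ∘ cyc)
      U-independent : Independent₂ (_∈ coordinates) U
      U-independent = F₂.independent-++ λ c d Σ≡0 →
        let Σx≡0 , d≡0 = primal+cyclic-injective D (comb₂ c x) d
              (λ i i∈ → trans (cong (_xor comb₂ d (cyclic ∘ cyc) i) (sym (comb-primal c x i))) (Σ≡0 i i∈))
        in x-ind c (λ i _ → Σx≡0 i) , d≡0
      orthogonal : ∀ v a → F₂.dot coordinates (dual (eqFin v)) (U a) ≡ false
      orthogonal v a with Fin.splitAt k a
      ... | inj₁ b = dual⊥primal (eqFin v) (x b) (Lx≡sx b)
      ... | inj₂ q = dual⊥cyclic (eqFin v) (cyc q)

-- Components and bicycles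

count-cong : ∀ {k} {p q : Fin k → Bool} → (∀ i → p i ≡ q i) → count p ≡ count q
count-cong {zero}  p≡q = refl
count-cong {suc k} p≡q = cong₂ (λ b m → (if b then 1 else 0) ℕ.+ m) (p≡q zero) (count-cong (p≡q ∘ suc))

count-true : ∀ k → count {k} (λ _ → true) ≡ k
count-true zero    = refl
count-true (suc k) = cong suc (count-true k)

count-false : ∀ k → count {k} (λ _ → false) ≡ 0
count-false zero    = refl
count-false (suc k) = count-false k

count-not : ∀ {k} (p : Fin k → Bool) → count (not ∘ p) ℕ.+ count p ≡ k
count-not {zero}  p = refl
count-not {suc k} p with p zero
... | true  = trans (ℕₚ.+-suc _ _) (cong suc (count-not (p ∘ suc)))
... | false = cong suc (count-not (p ∘ suc))

count≤ : ∀ {k} (p : Fin k → Bool) → count p ℕ.≤ k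
count≤ p = ℕₚ.≤-trans (ℕₚ.m≤n+m (count p) (count (not ∘ p))) (ℕₚ.≤-reflexive (count-not p))

count-mono : ∀ {k} (p q : Fin k → Bool) → (∀ i → p i ≡ true → q i ≡ true) → count p ℕ.≤ count q
count-mono {zero}  p q p⊆q = z≤n
count-mono {suc k} p q p⊆q with p zero in p0 | q zero in q0
... | true  | true  = s≤s (count-mono (p ∘ suc) (q ∘ suc) (p⊆q ∘ suc))
... | true  | false = contradiction (trans (sym q0) (p⊆q zero p0)) λ ()
... | false | true  = ℕₚ.m≤n⇒m≤1+n (count-mono (p ∘ suc) (q ∘ suc) (p⊆q ∘ suc))
... | false | false = count-mono (p ∘ suc) (q ∘ suc) (p⊆q ∘ suc)

count-mono-< : ∀ {k} (p q : Fin k → Bool) → (∀ i → p i ≡ true → q i ≡ true) →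
               ∀ i → p i ≡ false → q i ≡ true → count p ℕ.< count q
count-mono-< p q p⊆q zero    pi qi rewrite pi | qi = s≤s (count-mono (p ∘ suc) (q ∘ suc) (p⊆q ∘ suc))
count-mono-< p q p⊆q (suc i) pi qi with p zero in p0 | q zero in q0
... | true  | true  = s≤s (count-mono-< (p ∘ suc) (q ∘ suc) (p⊆q ∘ suc) i pi qi)
... | true  | false = contradiction (trans (sym q0) (p⊆q zero p0)) λ ()
... | false | true  = ℕₚ.m≤n⇒m≤1+n (count-mono-< (p ∘ suc) (q ∘ suc) (p⊆q ∘ suc) i pi qi)
... | false | false = count-mono-< (p ∘ suc) (q ∘ suc) (p⊆q ∘ suc) i pi qi

allFin⁻ : ∀ {k} (p : Fin k → Bool) → allFin p ≡ true → ∀ i → p i ≡ true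
allFin⁻ p all zero    = proj₁ (∧-true all)
allFin⁻ p all (suc i) = allFin⁻ (p ∘ suc) (proj₂ (∧-true {p zero} all)) i

allFin-false : ∀ {k} (p : Fin k → Bool) → allFin p ≡ false → ∃ λ i → p i ≡ false
allFin-false {suc k} p ¬all with p zero in p0
... | false = zero , p0
... | true  = let i , pi = allFin-false (p ∘ suc) ¬all in suc i , pi

anyFin⁺ : ∀ {k} (p : Fin k → Bool) i → p i ≡ true → anyFin p ≡ true
anyFin⁺ p zero    pi rewrite pi = refl
anyFin⁺ p (suc i) pi = trans (cong (p zero ∨_) (anyFin⁺ (p ∘ suc) i pi)) (𝔹ₚ.∨-zeroʳ (p zero))

anyFin⁻ : ∀ {k} (p : Fin k → Bool) → anyFin p ≡ true → ∃ λ i → p i ≡ true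
anyFin⁻ {suc k} p any with p zero in p0
... | true  = zero , p0
... | false = let i , pi = anyFin⁻ (p ∘ suc) any in suc i , pi

∨-true : ∀ {a b} → a ∨ b ≡ true → a ≡ true ⊎ b ≡ true
∨-true {true}  _   = inj₁ refl
∨-true {false} b≡1 = inj₂ b≡1

⇒-false : ∀ {a b} → not a ∨ b ≡ false → a ≡ true × b ≡ false
⇒-false {true} b≡0 = refl , b≡0

⇒-true : ∀ {a b} → not a ∨ b ≡ true → a ≡ true → b ≡ true
⇒-true ¬a∨b refl = ¬a∨b

module _ (G : Graph) where
  private
    V : Set
    V = Fin (n G)

  reachN-suc : ∀ k {u v} → reachN G (suc k) u v ≡ true →
               reachN G k u v ≡ true ⊎ ∃ λ w → reachN G k u w ≡ true × adj G w v ≡ true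
  reachN-suc k {u} {v} uv with ∨-true {reachN G k u v} uv
  ... | inj₁ uv′ = inj₁ uv′
  ... | inj₂ any = let w , uwv = anyFin⁻ (λ w → reachN G k u w ∧ adj G w v) any in inj₂ (w , ∧-true uwv)

  reachN-weaken : ∀ k {u v} → reachN G k u v ≡ true → reachN G (suc k) u v ≡ true
  reachN-weaken k uv rewrite uv = refl

  reachN-step : ∀ k {u v w} → reachN G k u v ≡ true → adj G v w ≡ true → reachN G (suc k) u w ≡ true
  reachN-step k {u} {v} {w} uv vw = trans
    (cong (reachN G k u w ∨_) (anyFin⁺ (λ v → reachN G k u v ∧ adj G v w) v (cong₂ _∧_ uv vw)))
    (𝔹ₚ.∨-zeroʳ (reachN G k u w))

  reachN-refl : ∀ k u → reachN G k u u ≡ true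
  reachN-refl zero    u = eqFin-refl u
  reachN-refl (suc k) u = reachN-weaken k (reachN-refl k u)

  Saturated : ℕ → V → Set
  Saturated k u = ∀ {v w} → reachN G k u v ≡ true → adj G v w ≡ true → reachN G k u w ≡ true

  saturated-suc : ∀ {k u} → Saturated k u → Saturated (suc k) u
  saturated-suc {k} sat uv vw with reachN-suc k uv
  ... | inj₁ uv′             = reachN-weaken k (sat uv′ vw)
  ... | inj₂ (w , uw , wv)   = reachN-weaken k (sat (sat uw wv) vw)

  -- As long as the reached set is not saturated, each step adds a vertex.
  saturated-or-large : ∀ k u → Saturated k u ⊎ k ℕ.< count (reachN G k u)
  saturated-or-large zero u = inj₂ (subst (ℕ._< count (eqFin u)) (count-false (n G))
    (count-mono-< (λ _ → false) (eqFin u) (λ _ ()) u refl (eqFin-refl u)))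
  saturated-or-large (suc k) u with saturated-or-large k u
  ... | inj₁ sat   = inj₁ (saturated-suc {k} sat)
  ... | inj₂ large with any? (λ w → (reachN G (suc k) u w 𝔹ₚ.≟ true) ×-dec (reachN G k u w 𝔹ₚ.≟ false))
  ...   | yes (w , new , ¬old) = inj₂ (ℕₚ.<-≤-trans (s≤s large)
            (count-mono-< (reachN G k u) (reachN G (suc k) u) (λ _ → reachN-weaken k) w ¬old new))
  ...   | no  none = inj₁ (saturated-suc {k} λ uv vw →
            𝔹ₚ.¬-not (λ ¬uw → none (_ , reachN-step k uv vw , ¬uw)))

  -- `n G` rounds suffice: an unsaturated set would by then contain more than `n G` vertices.
  reach-step : ∀ {u v w} → reach G u v ≡ true → adj G v w ≡ true → reach G u w ≡ true
  reach-step {u} with saturated-or-large (n G) u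
  ... | inj₁ sat   = sat
  ... | inj₂ large = contradiction (count≤ (reach G u)) (ℕₚ.<⇒≱ large)

  reach-trans : ∀ k {u v w} → reach G u v ≡ true → reachN G k v w ≡ true → reach G u w ≡ true
  reach-trans zero    {v = v} {w} uv vw with refl ← eqFin⇒≡ v w vw = uv
  reach-trans (suc k) uv vw with reachN-suc k vw
  ... | inj₁ vw′           = reach-trans k uv vw′
  ... | inj₂ (z , vz , zw) = reach-step (reach-trans k uv vz) zw

  reach-sym : ∀ k {u v} → reachN G k u v ≡ true → reach G v u ≡ true
  reach-sym zero    {u} {v} uv with refl ← eqFin⇒≡ u v uv = reachN-refl (n G) u
  reach-sym (suc k) {v = v} uv with reachN-suc k uv
  ... | inj₁ uv′           = reach-sym k uv′
  ... | inj₂ (w , uw , wv) = reach-trans (n G)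
          (reach-step (reachN-refl (n G) v) (trans (adj-sym G v w) wv)) (reach-sym k uw)

  reachN-constant : ∀ {x} → LocallyConstant G x → ∀ k {u v} → reachN G k u v ≡ true → x u ≡ x v
  reachN-constant {x} const zero    {u} {v} uv = cong x (eqFin⇒≡ u v uv)
  reachN-constant const (suc k) uv with reachN-suc k uv
  ... | inj₁ uv′           = reachN-constant const k uv′
  ... | inj₂ (w , uw , wv) = trans (reachN-constant const k uw) (const w _ wv)

  rep-minimal : ∀ {u v} → isRep G u ≡ true → reach G u v ≡ true → toℕ u ℕ.≤ toℕ v
  rep-minimal {u} {v} rep uv = ℕₚ.≤ᵇ⇒≤ _ _ (Equivalence.from 𝔹ₚ.T-≡
    (⇒-true (allFin⁻ (λ v → not (reach G u v) ∨ (toℕ u ℕ.≤ᵇ toℕ v)) rep v) uv))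

  reps-separated : ∀ {u v} → isRep G u ≡ true → isRep G v ≡ true → reach G u v ≡ true → u ≡ v
  reps-separated u-rep v-rep uv = Finₚ.toℕ-injective
    (ℕₚ.≤-antisym (rep-minimal u-rep uv) (rep-minimal v-rep (reach-sym (n G) uv)))

  -- Descent on the vertex number: a vertex that is not a representative reaches a smaller one,
  -- where x takes the same value.
  vanishes-on-reps : ∀ {x} → LocallyConstant G x → (∀ v → isRep G v ≡ true → x v ≡ false) → ∀ u → x u ≡ false
  vanishes-on-reps {x} const x≡0 u = go u (<-wellFounded (toℕ u))
    where
    go : ∀ u → Acc ℕ._<_ (toℕ u) → x u ≡ false
    go u (acc rec) with isRep G u in rep
    ... | true  = x≡0 u rep
    ... | false with w , w-smaller ← allFin-false (λ v → not (reach G u v) ∨ (toℕ u ℕ.≤ᵇ toℕ v)) rep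
                with uw , u≰w ← ⇒-false {reach G u w} w-smaller
        = trans (reachN-constant const (n G) uw) (go w (rec (ℕₚ.≰⇒> λ u≤w →
            contradiction (trans (sym u≰w) (Equivalence.to 𝔹ₚ.T-≡ (ℕₚ.≤⇒≤ᵇ u≤w))) λ ())))

  rigid-reps : ∀ s → Rigid G s (isRep G)
  rigid-reps s x const _ = vanishes-on-reps const

  isEvenRep : V → Bool
  isEvenRep v = isRep G v ∧ allFin (λ u → not (reach G v u) ∨ isEven (deg G u))

  -- In a component with an odd-degree vertex, `s` alone forces a locally constant function to
  -- vanish. Only even components still need their representative, which is where `nCe` comes from.
  rigid-evenReps : ∀ s → (∀ u → s u ≡ not (isEven (deg G u))) → Rigid G s isEvenRep
  rigid-evenReps s s≡odd x const x-odd≡0 x-even≡0 = vanishes-on-reps const on-rep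
    where
    on-rep : ∀ v → isRep G v ≡ true → x v ≡ false
    on-rep v rep with allFin (λ u → not (reach G v u) ∨ isEven (deg G u)) in even
    ... | true  = x-even≡0 v (cong₂ _∧_ rep even)
    ... | false with w , w-odd ← allFin-false (λ u → not (reach G v u) ∨ isEven (deg G u)) even
                with vw , w-odd′ ← ⇒-false {reach G v w} w-odd
        = trans (reachN-constant const (n G) vw) (x-odd≡0 w (trans (s≡odd w) (cong not w-odd′)))

  -- The Laplacian modulo 2, its kernel and its fixed vectors

  laplacian-expand : ∀ x u → laplacian G x u ≡ (odd (deg G u) ∧ x u) xor sum₂ (λ v → adj G u v ∧ x v)
  laplacian-expand x u = begin
    sum₂ (λ v → adj G u v ∧ (x u xor x v))
      ≡⟨ sum₂-cong (λ v → 𝔹ₚ.∧-distribˡ-xor (adj G u v) (x u) (x v)) ⟩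
    sum₂ (λ v → (adj G u v ∧ x u) xor (adj G u v ∧ x v))
      ≡⟨ sum₂-xor (λ v → adj G u v ∧ x u) (λ v → adj G u v ∧ x v) ⟩
    sum₂ (λ v → adj G u v ∧ x u) xor Ax
      ≡⟨ cong (_xor Ax) (∧-distribʳ-sum₂ (x u) (adj G u)) ⟨
    (sum₂ (adj G u) ∧ x u) xor Ax
      ≡⟨ cong (λ d → (d ∧ x u) xor Ax) (odd-count (adj G u)) ⟨
    (odd (deg G u) ∧ x u) xor Ax ∎
    where
    open ≡-Reasoning
    Ax = sum₂ (λ v → adj G u v ∧ x v)

  laplacianMod2 : V → V → Bool
  laplacianMod2 u v = (eqFin u v ∧ odd (deg G u)) xor adj G u v

  laplacianMod2-action : ∀ x u → sum₂ (λ v → laplacianMod2 u v ∧ x v) ≡ laplacian G x u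
  laplacianMod2-action x u = begin
    sum₂ (λ v → laplacianMod2 u v ∧ x v)
      ≡⟨ sum₂-cong (λ v → trans (𝔹ₚ.∧-distribʳ-xor (x v) (eqFin u v ∧ odd (deg G u)) (adj G u v))
           (cong (_xor (adj G u v ∧ x v)) (𝔹ₚ.∧-assoc (eqFin u v) (odd (deg G u)) (x v)))) ⟩
    sum₂ (λ v → (eqFin u v ∧ (odd (deg G u) ∧ x v)) xor (adj G u v ∧ x v))
      ≡⟨ sum₂-xor (λ v → eqFin u v ∧ (odd (deg G u) ∧ x v)) (λ v → adj G u v ∧ x v) ⟩
    sum₂ (λ v → eqFin u v ∧ (odd (deg G u) ∧ x v)) xor sum₂ (λ v → adj G u v ∧ x v)
      ≡⟨ cong (_xor sum₂ (λ v → adj G u v ∧ x v)) (sum₂-eqFin u (λ v → odd (deg G u) ∧ x v)) ⟩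
    (odd (deg G u) ∧ x u) xor sum₂ (λ v → adj G u v ∧ x v)
      ≡⟨ laplacian-expand x u ⟨
    laplacian G x u ∎
    where open ≡-Reasoning

  reduces-Amat : ∀ u v → Reduces (Amat G u v) (adj G u v)
  reduces-Amat u v with adj G u v
  ... | true  = reduces-1
  ... | false = reduces-0

  reduces-Dmat : ∀ u v → Reduces (Dmat G u v) (eqFin u v ∧ odd (deg G u))
  reduces-Dmat u v with eqFin u v
  ... | true  = + deg G u , refl , refl
  ... | false = reduces-0

  reduces-Lmat : ∀ u v → Reduces (Lmat G u v) (laplacianMod2 u v)
  reduces-Lmat u v = reduces-+ (reduces-Dmat u v) (reduces-neg (reduces-Amat u v))

  reduces-Qmat : ∀ u v → Reduces (Qmat G u v) (laplacianMod2 u v)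
  reduces-Qmat u v = reduces-+ (reduces-Dmat u v) (reduces-Amat u v)

  laplacian-symmetric : ∀ x y → sum₂ (λ u → x u ∧ laplacian G y u) ≡ sum₂ (λ u → y u ∧ laplacian G x u)
  laplacian-symmetric x y = trans (sym (green G x y)) (trans
    (sum₂-cong (λ u → sum₂-cong (λ v → cong ((adj G u v ∧ (toℕ u <ᵇ toℕ v)) ∧_) (𝔹ₚ.∧-comm (x u xor x v) (y u xor y v)))))
    (green G y x))

  laplacian-constant : ∀ {x} → LocallyConstant G x → ∀ u → laplacian G x u ≡ false
  laplacian-constant {x} const u = sum₂-false _ term≡0
    where
    term≡0 : ∀ v → adj G u v ∧ (x u xor x v) ≡ false
    term≡0 v with adj G u v in uv
    ... | true  = trans (cong (_xor x v) (const u v uv)) (𝔹ₚ.xor-same (x v))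
    ... | false = refl

  -- Being a cut, the bicycle has as its degree at `u` the number of cut edges there; being in the
  -- cycle space, it makes that degree even.
  laplacian-side : (B : Bicycle G) → ∀ u → laplacian G (side B) u ≡ false
  laplacian-side B u = begin
    laplacian G (side B) u          ≡⟨ sum₂-cong (isCut B u) ⟨
    sum₂ (mem B u)                  ≡⟨ odd-count (mem B u) ⟨
    odd (count (mem B u))           ≡⟨ odd≡¬even (count (mem B u)) ⟩
    not (isEven (count (mem B u)))  ≡⟨ cong not (isCyc B u) ⟩
    false                           ∎
    where open ≡-Reasoning

  kernel⊥fixed : ∀ y x → (∀ u → laplacian G y u ≡ false) → (∀ u → laplacian G x u ≡ x u) →
                 sum₂ (λ u → y u ∧ x u) ≡ false
  kernel⊥fixed y x Ly≡0 Lx≡x = begin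
    sum₂ (λ u → y u ∧ x u)              ≡⟨ sum₂-cong (λ u → cong (y u ∧_) (Lx≡x u)) ⟨
    sum₂ (λ u → y u ∧ laplacian G x u)  ≡⟨ laplacian-symmetric y x ⟩
    sum₂ (λ u → x u ∧ laplacian G y u)  ≡⟨ sum₂-false _ (λ u → trans (cong (x u ∧_) (Ly≡0 u)) (𝔹ₚ.∧-zeroʳ (x u))) ⟩
    false                               ∎
    where open ≡-Reasoning

  component : V → V → Bool
  component v u = isRep G v ∧ reach G v u

  component-constant : ∀ v → LocallyConstant G (component v)
  component-constant v u w uw = cong (isRep G v ∧_) (reach-agree (reach G v u) (reach G v w) refl refl)
    where
    reach-agree : ∀ a b → reach G v u ≡ a → reach G v w ≡ b → a ≡ b
    reach-agree true  true  _ _ = refl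
    reach-agree false false _ _ = refl
    reach-agree true  false vu ¬vw = trans (sym (reach-step vu uw)) ¬vw
    reach-agree false true  ¬vu vw = trans (sym ¬vu) (reach-step vw (trans (adj-sym G w u) uw))

  -- Evaluation at a representative picks out its own component, so the coefficients of a
  -- combination of components can be read off at the representatives.
  component-at-rep : ∀ {u} → isRep G u ≡ true → ∀ v → component v u ≡ eqFin v u
  component-at-rep {u} u-rep v with eqFin v u in eq
  ... | true  with refl ← eqFin⇒≡ v u eq = cong₂ _∧_ u-rep (reachN-refl (n G) v)
  ... | false = 𝔹ₚ.¬-not λ rep∧reach → let v-rep , vu = ∧-true rep∧reach in
          contradiction (trans (sym (eqFin-refl v))
            (trans (cong (eqFin v) (reps-separated v-rep u-rep vu)) eq)) λ ()

  -- component v vanishes unless v is a representative; the second block makes the family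
  -- indexed by all vertices independent, using one dimension per non-representative.
  blockCoordinates : List (V ⊎ V)
  blockCoordinates = select (λ _ → true) inj₁ ++ select (not ∘ isRep G) inj₂

  length-blockCoordinates : length blockCoordinates ≡ n G ℕ.+ count (not ∘ isRep G)
  length-blockCoordinates = trans (Listₚ.length-++ (select {k = n G} (λ _ → true) inj₁)) (cong₂ ℕ._+_
    (trans (length-select {k = n G} (λ _ → true) inj₁) (count-true (n G)))
    (length-select (not ∘ isRep G) inj₂))

  ∈-block₁ : ∀ v → inj₁ v ∈ blockCoordinates
  ∈-block₁ v = ∈-++⁺ˡ (∈-select (λ _ → true) inj₁ v refl)

  ∈-block₂ : ∀ v → isRep G v ≡ false → inj₂ v ∈ blockCoordinates
  ∈-block₂ v ¬rep = ∈-++⁺ʳ (select (λ _ → true) inj₁) (∈-select (not ∘ isRep G) inj₂ v (cong not ¬rep))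

  block : (V → Bool) → (V → Bool) → V ⊎ V → Bool
  block x y (inj₁ v) = x v
  block x y (inj₂ v) = y v

  dot-block : ∀ x y z → F₂.dot blockCoordinates (block x y) (block z (λ _ → false)) ≡ sum₂ (λ v → x v ∧ z v)
  dot-block x y z = begin
    F₂.dot blockCoordinates (block x y) (block z (λ _ → false))
      ≡⟨ sumOver-++ (select (λ _ → true) inj₁) _ product ⟩
    sumOver (select (λ _ → true) inj₁) product xor sumOver (select (not ∘ isRep G) inj₂) product
      ≡⟨ cong₂ _xor_ (sumOver-select (λ _ → true) inj₁ product) (sumOver-select (not ∘ isRep G) inj₂ product) ⟩
    sum₂ (λ v → x v ∧ z v) xor sum₂ (λ v → not (isRep G v) ∧ (y v ∧ false))
      ≡⟨ cong (sum₂ (λ v → x v ∧ z v) xor_) (sum₂-false _ (λ v →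
           trans (cong (not (isRep G v) ∧_) (𝔹ₚ.∧-zeroʳ (y v))) (𝔹ₚ.∧-zeroʳ (not (isRep G v))))) ⟩
    sum₂ (λ v → x v ∧ z v) xor false
      ≡⟨ 𝔹ₚ.xor-identityʳ _ ⟩
    sum₂ (λ v → x v ∧ z v) ∎
    where
    open ≡-Reasoning
    product : V ⊎ V → Bool
    product i = block x y i ∧ block z (λ _ → false) i

  -- The b sides and n component vectors are orthogonal to the k fixed vectors, inside n + (n - c)
  -- coordinates; cancelling n yields the bound. Sides and components must be shown independent of
  -- each other, although a side is determined by its bicycle only up to a locally constant
  -- function.
  bicycle-bound : ∀ {k b} (x : Fin k → V → Bool) → Independent₂ (λ _ → ⊤) x →
    (∀ a u → laplacian G (x a) u ≡ x a u) → BicycleFamily G b → k ℕ.+ b ℕ.+ nC G ℕ.≤ n G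
  bicycle-bound {k} {b} x x-ind Lx≡x B = arithmetic
    (subst ((b ℕ.+ n G) ℕ.+ k ℕ.≤_) length-blockCoordinates
      (F₂.orthogonal-bound blockCoordinates f u f-independent u-independent orthogonal))
    where
    open BicycleFamily B
    sides : Fin b → V ⊎ V → Bool
    components : V → V ⊎ V → Bool
    f : Fin (b ℕ.+ n G) → V ⊎ V → Bool
    sides a = block (side (bic a)) (λ _ → false)
    components v = block (component v) (eqFin v)
    f = sides Vec.++ components
    u : Fin k → V ⊎ V → Bool
    u a = block (x a) (λ _ → false)
    u-independent : Independent₂ (_∈ blockCoordinates) u
    u-independent c Σ≡0 = x-ind c (λ v _ → Σ≡0 (inj₁ v) (∈-block₁ v))
    orthogonal : ∀ p a → F₂.dot blockCoordinates (f p) (u a) ≡ false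
    orthogonal p a with Fin.splitAt b p
    ... | inj₁ q = trans (dot-block (side (bic q)) _ (x a))
                     (kernel⊥fixed (side (bic q)) (x a) (laplacian-side (bic q)) (Lx≡x a))
    ... | inj₂ v = trans (dot-block (component v) _ (x a))
                     (kernel⊥fixed (component v) (x a) (laplacian-constant (component-constant v)) (Lx≡x a))
    f-independent : Independent₂ (_∈ blockCoordinates) f
    f-independent = F₂.independent-++ λ c d Σ≡0 → independent c d Σ≡0
      where
      independent : ∀ c d → (∀ i → i ∈ blockCoordinates → comb₂ c sides i xor comb₂ d components i ≡ false) →
                    (∀ a → c a ≡ false) × (∀ v → d v ≡ false)
      independent c d Σ≡0 = c≡0 , d≡0
        where
        open ≡-Reasoning
        X Y : V → Bool
        X = comb₂ c (side ∘ bic)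
        Y = comb₂ d component
        X≡Y : ∀ v → X v ≡ Y v
        X≡Y v = xor-false⇒≡ (X v) (Y v) (Σ≡0 (inj₁ v) (∈-block₁ v))
        Y-constant : LocallyConstant G Y
        Y-constant v w vw = sum₂-cong (λ z → cong (d z ∧_) (component-constant z v w vw))
        cut≡0 : ∀ v w → adj G v w ∧ (X v xor X w) ≡ false
        cut≡0 v w with adj G v w in vw
        ... | false = refl
        ... | true  = begin
          X v xor X w  ≡⟨ cong₂ _xor_ (X≡Y v) (X≡Y w) ⟩
          Y v xor Y w  ≡⟨ cong (_xor Y w) (Y-constant v w vw) ⟩
          Y w xor Y w  ≡⟨ 𝔹ₚ.xor-same (Y w) ⟩
          false        ∎
        -- The combination of sides agrees with a combination of components, hence is locally
        -- constant and has empty cut; that cut is the same combination of the bicycles.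
        c≡0 : ∀ a → c a ≡ false
        c≡0 = indep c λ v w → begin
          xorSum (λ a → c a ∧ mem (bic a) v w)
            ≡⟨ xorSum≡sum₂ (λ a → c a ∧ mem (bic a) v w) ⟩
          sum₂ (λ a → c a ∧ mem (bic a) v w)
            ≡⟨ sum₂-cong (λ a → trans (cong (c a ∧_) (isCut (bic a) v w)) (∧-swap (c a) (adj G v w) _)) ⟩
          sum₂ (λ a → adj G v w ∧ (c a ∧ (side (bic a) v xor side (bic a) w)))
            ≡⟨ ∧-distribˡ-sum₂ (adj G v w) (λ a → c a ∧ (side (bic a) v xor side (bic a) w)) ⟨
          adj G v w ∧ sum₂ (λ a → c a ∧ (side (bic a) v xor side (bic a) w))
            ≡⟨ cong (adj G v w ∧_) (comb-coboundary G c (side ∘ bic) v w) ⟩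
          adj G v w ∧ (X v xor X w)
            ≡⟨ cut≡0 v w ⟩
          false ∎
        Y≡0 : ∀ v → Y v ≡ false
        Y≡0 v = trans (sym (X≡Y v)) (sum₂-false _ (λ a → cong (_∧ side (bic a) v) (c≡0 a)))
        d≡0 : ∀ v → d v ≡ false
        -- At a representative the first block reads off the coefficient; at any other vertex the
        -- second block does.
        d≡0 v with isRep G v in rep
        ... | true  = begin
          d v                                 ≡⟨ comb-eqFin d v ⟨
          sum₂ (λ w → d w ∧ eqFin w v)        ≡⟨ sum₂-cong (λ w → cong (d w ∧_) (component-at-rep rep w)) ⟨
          Y v                                 ≡⟨ Y≡0 v ⟩
          false                               ∎
        ... | false = begin
          d v                                 ≡⟨ comb-eqFin d v ⟨
          comb₂ d components (inj₂ v)         ≡⟨ cong (_xor comb₂ d components (inj₂ v)) (comb-false c) ⟨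
          comb₂ c sides (inj₂ v) xor comb₂ d components (inj₂ v)
                                              ≡⟨ Σ≡0 (inj₂ v) (∈-block₂ v rep) ⟩
          false                               ∎
    arithmetic : (b ℕ.+ n G) ℕ.+ k ℕ.≤ n G ℕ.+ count (not ∘ isRep G) → k ℕ.+ b ℕ.+ nC G ℕ.≤ n G
    arithmetic le = ℕₚ.+-cancelˡ-≤ (n G) _ _ (begin
      n G ℕ.+ (k ℕ.+ b ℕ.+ nC G)              ≡⟨ solve 4 (λ n k b c → n :+ (k :+ b :+ c) := b :+ n :+ k :+ c) refl (n G) k b (nC G) ⟩
      b ℕ.+ n G ℕ.+ k ℕ.+ nC G                ≤⟨ ℕₚ.+-monoˡ-≤ (nC G) le ⟩
      n G ℕ.+ count (not ∘ isRep G) ℕ.+ nC G  ≡⟨ ℕₚ.+-assoc (n G) _ _ ⟩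
      n G ℕ.+ (count (not ∘ isRep G) ℕ.+ nC G) ≡⟨ cong (n G ℕ.+_) (count-not (isRep G)) ⟩
      n G ℕ.+ n G                             ∎)
      where
      open ℕₚ.≤-Reasoning
      open ℕ-Solver

-- From integer matrices to the stated bounds

reduce-laplacian-eigenfamily : ∀ G {k μ} {M : Mat (n G)} ν → (∀ u v → Reduces (M u v) (laplacianMod2 G u v)) → Reduces μ ν →
  EigFamily M μ k → ∃ λ (x : Fin k → Fin (n G) → Bool) → Independent₂ (λ _ → ⊤) x ×
    (∀ a u → laplacian G (x a) u ≡ ν ∧ x a u)
reduce-laplacian-eigenfamily G ν M-L μ-ν E with x , x-ind , Lx ← reduce-eigenfamily (laplacianMod2 G) ν M-L μ-ν E
  = x , x-ind , λ a u → trans (sym (laplacianMod2-action G (x a) u)) (Lx a u)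

adjacency-bound : ∀ G {k t μ} ν r → Rigid G (λ u → odd (deg G u) xor ν) r → Reduces μ ν →
  EigFamily (Amat G) μ k → DisjOddCycles G t →
  n G ℕ.+ (k ℕ.+ t) ℕ.≤ nE G ℕ.+ (count (λ u → odd (deg G u) xor ν) ℕ.+ (count r ℕ.+ count r))
adjacency-bound G ν r rigid μ-ν E D with x , x-ind , Ax ← reduce-eigenfamily (adj G) ν (reduces-Amat G) μ-ν E
  = laplacian-bound G (λ u → odd (deg G u) xor ν) r rigid x x-ind
      (λ a u → trans (laplacian-expand G (x a) u)
        (trans (cong ((odd (deg G u) ∧ x a u) xor_) (Ax a u)) (sym (𝔹ₚ.∧-distribʳ-xor (x a u) (odd (deg G u)) ν)))) D

open import Data.Integer using (_+_; _-_; _*_; _≤_)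
open ℤ-Solver using (solve; con; _:=_; _:+_; _:-_; _:*_)

-- Truncated subtraction is avoided: the dimension counts are inequalities of natural numbers, and
-- the stated bounds differ from them by a ring identity between differences of integers, left to
-- the solver.
difference⇒≤ : ∀ {i j p q} → j - i ≡ q - p → p ≤ q → i ≤ j
difference⇒≤ eq p≤q = ℤₚ.0≤i-j⇒j≤i (subst (+ 0 ≤_) (sym eq) (ℤₚ.i≤j⇒0≤j-i p≤q))

adjacency-even-arithmetic : ∀ N k t E o e c i → N ℕ.+ (k ℕ.+ t) ℕ.≤ E ℕ.+ (o ℕ.+ (e ℕ.+ e)) →
  + k ≤ (+ E - + N) + + c - + t + + o + + 2 * + e - + c + + 2 * + i
adjacency-even-arithmetic N k t E o e c i le = difference⇒≤ {p = + (N ℕ.+ (k ℕ.+ t))} {+ (E ℕ.+ (o ℕ.+ (e ℕ.+ e)) ℕ.+ (i ℕ.+ i))}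
  (solve 8 (λ N k t E o e c i →
      (E :- N) :+ c :- t :+ o :+ con (+ 2) :* e :- c :+ con (+ 2) :* i :- k
        := E :+ (o :+ (e :+ e)) :+ (i :+ i) :- (N :+ (k :+ t))) refl (+ N) (+ k) (+ t) (+ E) (+ o) (+ e) (+ c) (+ i))
  (ℤ.+≤+ (ℕₚ.≤-trans le (ℕₚ.m≤m+n _ (i ℕ.+ i))))

adjacency-odd-arithmetic : ∀ N k t E s c → N ℕ.+ (k ℕ.+ t) ℕ.≤ E ℕ.+ (s ℕ.+ (c ℕ.+ c)) →
  + k ≤ (+ E - + N) + + c - + t + + s + + c
adjacency-odd-arithmetic N k t E s c le = difference⇒≤ {p = + (N ℕ.+ (k ℕ.+ t))} {+ (E ℕ.+ (s ℕ.+ (c ℕ.+ c)))}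
  (solve 6 (λ N k t E s c →
      (E :- N) :+ c :- t :+ s :+ c :- k := E :+ (s :+ (c :+ c)) :- (N :+ (k :+ t)))
    refl (+ N) (+ k) (+ t) (+ E) (+ s) (+ c))
  (ℤ.+≤+ le)

laplacian-even-arithmetic : ∀ N k t E c → N ℕ.+ (k ℕ.+ t) ℕ.≤ E ℕ.+ (0 ℕ.+ (c ℕ.+ c)) →
  + k ≤ (+ E - + N) + + c - + t + + c
laplacian-even-arithmetic N k t E c le = difference⇒≤ {p = + (N ℕ.+ (k ℕ.+ t))} {+ (E ℕ.+ (c ℕ.+ c))}
  (solve 5 (λ N k t E c →
      (E :- N) :+ c :- t :+ c :- k := E :+ (c :+ c) :- (N :+ (k :+ t)))
    refl (+ N) (+ k) (+ t) (+ E) (+ c))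
  (ℤ.+≤+ le)

laplacian-odd-arithmetic : ∀ N k b c → k ℕ.+ b ℕ.+ c ℕ.≤ N → + k ≤ + N - + b - + c
laplacian-odd-arithmetic N k b c le = difference⇒≤ {p = + (k ℕ.+ b ℕ.+ c)} {+ N}
  (solve 4 (λ N k b c → N :- b :- c :- k := N :- (k :+ b :+ c)) refl (+ N) (+ k) (+ b) (+ c))
  (ℤ.+≤+ le)

theorem1 : (G : Graph) (λ' : ℤ) →
    (+ 2 ∣ λ' → ∀ k t → EigFamily (Amat G) (λ' / 1) k → DisjOddCycles G t →
    + k ≤ θ G - + t + + nVo G + + 2 * + nCe G - + nC G + + 2 * + iG G)
    × (¬ (+ 2 ∣ λ') → ∀ k t → EigFamily (Amat G) (λ' / 1) k → DisjOddCycles G t →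
    + k ≤ θ G - + t + + nVe G + + nC G)
    × (+ 2 ∣ λ' → ∀ k t → EigFamily (Lmat G) (λ' / 1) k → DisjOddCycles G t →
    + k ≤ θ G - + t + + nC G)
    × (+ 2 ∣ λ' → ∀ k t → EigFamily (Qmat G) (λ' / 1) k → DisjOddCycles G t →
    + k ≤ θ G - + t + + nC G)
    × (¬ (+ 2 ∣ λ') → ∀ k b → EigFamily (Lmat G) (λ' / 1) k → BicycleFamily G b →
    + k ≤ + nV G - + b - + nC G)
    × (¬ (+ 2 ∣ λ') → ∀ k b → EigFamily (Qmat G) (λ' / 1) k → BicycleFamily G b →
    + k ≤ + nV G - + b - + nC G)
theorem1 G λ' = adjacency-even , adjacency-odd
  , laplacian-even (reduces-Lmat G) , laplacian-even (reduces-Qmat G)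
  , laplacian-odd (reduces-Lmat G) , laplacian-odd (reduces-Qmat G)
  where
  even : + 2 ∣ λ' → Reduces (λ' / 1) false
  even 2∣λ = λ' , refl , 2∣⇒¬odd 2∣λ
  odd-λ : ¬ (+ 2 ∣ λ') → Reduces (λ' / 1) true
  odd-λ 2∤λ = λ' , refl , 𝔹ₚ.¬-not (2∤λ ∘ ¬odd⇒2∣ ∣ λ' ∣)
  s≡odd : ∀ u → odd (deg G u) xor false ≡ not (isEven (deg G u))
  s≡odd u = trans (𝔹ₚ.xor-identityʳ _) (odd≡¬even (deg G u))
  -- For odd eigenvalues the mask deg + 1 marks the vertices of even degree, which turns its count
  -- into `nVe`.
  s≡even : ∀ u → odd (deg G u) xor true ≡ isEven (deg G u)
  s≡even u = trans (𝔹ₚ.xor-comm (odd (deg G u)) true)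
    (trans (cong not (odd≡¬even (deg G u))) (𝔹ₚ.not-involutive (isEven (deg G u))))

  adjacency-even : + 2 ∣ λ' → ∀ k t → EigFamily (Amat G) (λ' / 1) k → DisjOddCycles G t →
    + k ≤ θ G - + t + + nVo G + + 2 * + nCe G - + nC G + + 2 * + iG G
  adjacency-even 2∣λ k t E D = adjacency-even-arithmetic (n G) k t (nE G) (nVo G) (nCe G) (nC G) (iG G)
    (subst (λ s → n G ℕ.+ (k ℕ.+ t) ℕ.≤ nE G ℕ.+ (s ℕ.+ (nCe G ℕ.+ nCe G))) (count-cong s≡odd)
      (adjacency-bound G false (isEvenRep G) (rigid-evenReps G _ s≡odd) (even 2∣λ) E D))

  adjacency-odd : ¬ (+ 2 ∣ λ') → ∀ k t → EigFamily (Amat G) (λ' / 1) k → DisjOddCycles G t →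
    + k ≤ θ G - + t + + nVe G + + nC G
  adjacency-odd 2∤λ k t E D = adjacency-odd-arithmetic (n G) k t (nE G) (nVe G) (nC G)
    (subst (λ s → n G ℕ.+ (k ℕ.+ t) ℕ.≤ nE G ℕ.+ (s ℕ.+ (nC G ℕ.+ nC G))) (count-cong s≡even)
      (adjacency-bound G true (isRep G) (rigid-reps G _) (odd-λ 2∤λ) E D))

  laplacian-even : ∀ {M} → (∀ u v → Reduces (M u v) (laplacianMod2 G u v)) → + 2 ∣ λ' → ∀ k t →
    EigFamily M (λ' / 1) k → DisjOddCycles G t → + k ≤ θ G - + t + + nC G
  laplacian-even M-L 2∣λ k t E D = laplacian-even-arithmetic (n G) k t (nE G) (nC G)
    -- The reduced vectors lie in the kernel of the Laplacian, so the correcting mask is empty and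
    -- its count is 0.
    (subst (λ s → n G ℕ.+ (k ℕ.+ t) ℕ.≤ nE G ℕ.+ (s ℕ.+ (nC G ℕ.+ nC G))) (count-false (n G))
      (let x , x-ind , Lx = reduce-laplacian-eigenfamily G false M-L (even 2∣λ) E in
       laplacian-bound G (λ _ → false) (isRep G) (rigid-reps G _) x x-ind Lx D))

  laplacian-odd : ∀ {M} → (∀ u v → Reduces (M u v) (laplacianMod2 G u v)) → ¬ (+ 2 ∣ λ') → ∀ k b →
    EigFamily M (λ' / 1) k → BicycleFamily G b → + k ≤ + nV G - + b - + nC G
  laplacian-odd M-L 2∤λ k b E B = laplacian-odd-arithmetic (n G) k b (nC G)
    (let x , x-ind , Lx = reduce-laplacian-eigenfamily G true M-L (odd-λ 2∤λ) E in
     bicycle-bound G x x-ind Lx B)
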